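{- Suppose that $\kappa$ is a non-Galvin cardinal. Then $\kappa$ carries a $\kappa$-complete ultrafilter $U$ such that $\neg\mathrm{Gal}(U,\kappa,\kappa^+)$. In particular, if in addition $2^\kappa=\kappa^+$, then $U$ is a non-Galvin ultrafilter.
   Context: Non-Galvin cardinal: $\kappa$ is a non-Galvin cardinal if there are elementary embeddings $j:V\to M$, $i:V\to N$, $k:N\to M$ (with $M,N$ transitive inner models) such that: (1) $k\circ i=j$; (2) the critical point of $j$ is $\kappa$ and the critical point of $k$ is $i(\kappa)$; (3) ${}^\kappa N\subseteq N$ and ${}^\kappa M\subseteq M$; (4) there is $A\in M$ such that $\{i(\alpha)\mid\alpha<\kappa^+\}\subseteq A$ and $M\models|A|<i(\kappa)$. For a uniform ultrafilter $U$ over $\kappa$ and cardinals $\mu\le\lambda$, $\mathrm{Gal}(U,\mu,\lambda)$ is the statement that for every sequence $\langle A_i\rangle_{i<\lambda}$ of members of $U$ there is $I\subseteq\lambda$ with $|I|=\mu$ and $\bigcap_{i\in I}A_i\in U$. $U$ is non-Galvin if $\mathrm{Gal}(U,\kappa,2^\kappa)$ fails. $\kappa$-complete ultrafilters over $\kappa$ are understood to be nonprincipal. -}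

module Defs where

open import Level using (Level; suc)
open import Data.Nat.Base using (ℕ) renaming (suc to 1+)
open import Data.Fin.Base using (Fin)
open import Data.Vec.Base using (Vec; []; _∷_; lookup; map)
open import Data.Vec.Relation.Unary.All using (All)
open import Data.Product.Base using (Σ; ∃; _×_)
open import Data.Sum.Base using (_⊎_)
open import Data.Empty.Polymorphic using (⊥)
open import Data.Unit.Polymorphic.Base using (⊤)
open import Function.Bundles using (_⇔_)
open import Relation.Nullary.Negation.Core using (¬_)
open import Relation.Binary.PropositionalEquality.Core using (_≡_; _≢_)

-- A structure for the language of set theory with class predicates.  `Cls n`
-- names some n-ary relations on V ("classes of n-tuples"); they may occur as
-- parameters in the axiom schemas below.  Taking the relations definable from
-- parameters gives plain ZFC with definable classes; taking the classes of a
-- model of Gödel–Bernays set theory gives the class-theoretic reading.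
record Universe (ℓ : Level) : Set (suc ℓ) where
  infix 4 _∈_ _∋_
  field
    V   : Set ℓ
    _∈_ : V → V → Set ℓ
    Cls : ℕ → Set ℓ
    _∋_ : ∀ {n} → Cls n → Vec V n → Set ℓ

infix 9 _∈̇_ _≡̇_
infix 8 ¬̇_
infixr 7 _∧̇_
infixr 6 _∨̇_
infixr 5 _⇒̇_
infix 4 _⇔̇_
infix 8 ∀̇_ ∃̇_

-- First-order formulas over ∈, = and the relation symbols P, with n free
-- variables (de Bruijn indices).
data Formula {ℓ} (P : ℕ → Set ℓ) (n : ℕ) : Set ℓ where
  _∈̇_ _≡̇_             : Fin n → Fin n → Formula P n
  rel                 : ∀ {k} → P k → Vec (Fin n) k → Formula P n
  ¬̇_                  : Formula P n → Formula P n
  _∧̇_ _∨̇_ _⇒̇_ _⇔̇_     : Formula P n → Formula P n → Formula P n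
  ∀̇_ ∃̇_               : Formula P (1+ n) → Formula P n

module _ {ℓ : Level} (𝒰 : Universe ℓ) where
  open Universe 𝒰

  Interpretation : (ℕ → Set ℓ) → Set (suc ℓ)
  Interpretation P = ∀ {k} → P k → Vec V k → Set ℓ

  NoSymbols : ℕ → Set ℓ
  NoSymbols _ = ⊥

  noSymbols : Interpretation NoSymbols
  noSymbols ()

  𝕍 : V → Set ℓ
  𝕍 _ = ⊤

  -- Everything in this module is relativized to D: all quantifiers range over
  -- D, so that `Relativized.φ D` is φ^D, i.e. "D ⊨ φ".
  module Relativized (D : V → Set ℓ) where

    ∀ᴰ ∃ᴰ : (V → Set ℓ) → Set ℓ
    ∀ᴰ Q = ∀ x → D x → Q x
    ∃ᴰ Q = ∃ λ x → D x × Q x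

    infixr 1 ∀ᴰ ∃ᴰ
    syntax ∀ᴰ (λ x → Q) = ∀ᴰ[ x ] Q
    syntax ∃ᴰ (λ x → Q) = ∃ᴰ[ x ] Q

    Sat : ∀ {P : ℕ → Set ℓ} → Interpretation P → ∀ {n} → Formula P n → Vec V n → Set ℓ
    Sat I (x ∈̇ y)    ρ = lookup ρ x ∈ lookup ρ y
    Sat I (x ≡̇ y)    ρ = lookup ρ x ≡ lookup ρ y
    Sat I (rel R xs) ρ = I R (map (lookup ρ) xs)
    Sat I (¬̇ φ)      ρ = ¬ Sat I φ ρ
    Sat I (φ ∧̇ ψ)    ρ = Sat I φ ρ × Sat I ψ ρ
    Sat I (φ ∨̇ ψ)    ρ = Sat I φ ρ ⊎ Sat I ψ ρ
    Sat I (φ ⇒̇ ψ)    ρ = Sat I φ ρ → Sat I ψ ρ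
    Sat I (φ ⇔̇ ψ)    ρ = Sat I φ ρ ⇔ Sat I ψ ρ
    Sat I (∀̇ φ)      ρ = ∀ᴰ[ x ] Sat I φ (x ∷ ρ)
    Sat I (∃̇ φ)      ρ = ∃ᴰ[ x ] Sat I φ (x ∷ ρ)

    IsEmpty : V → Set ℓ
    IsEmpty x = ∀ᴰ[ z ] ¬ z ∈ x

    _⊆_ : V → V → Set ℓ
    x ⊆ y = ∀ᴰ[ z ] (z ∈ x → z ∈ y)

    -- u = {x , y}
    IsUnorderedPair : V → V → V → Set ℓ
    IsUnorderedPair u x y = ∀ᴰ[ z ] (z ∈ u ⇔ (z ≡ x ⊎ z ≡ y))

    -- p = ⟨x , y⟩ = {{x} , {x , y}}
    IsOrderedPair : V → V → V → Set ℓ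
    IsOrderedPair p x y = ∃ᴰ[ s ] ∃ᴰ[ t ]
      (IsUnorderedPair s x x × IsUnorderedPair t x y × IsUnorderedPair p s t)

    -- s = x ∪ {x}
    IsSuccessor : V → V → Set ℓ
    IsSuccessor s x = ∀ᴰ[ z ] (z ∈ s ⇔ (z ∈ x ⊎ z ≡ x))

    IsPowerset : V → V → Set ℓ
    IsPowerset p x = ∀ᴰ[ z ] (z ∈ p ⇔ z ⊆ x)

    -- ⟨x , y⟩ ∈ f
    Maps : V → V → V → Set ℓ
    Maps f x y = ∃ᴰ[ p ] (IsOrderedPair p x y × p ∈ f)

    -- f is a function with domain a
    IsFunctionOn : V → V → Set ℓ
    IsFunctionOn f a =
        (∀ᴰ[ p ] (p ∈ f → ∃ᴰ[ x ] ∃ᴰ[ y ] (x ∈ a × IsOrderedPair p x y)))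
      × (∀ᴰ[ x ] (x ∈ a → ∃ᴰ[ y ] Maps f x y))
      × (∀ᴰ[ x ] ∀ᴰ[ y ] ∀ᴰ[ z ] (Maps f x y → Maps f x z → y ≡ z))

    IsBijection : V → V → V → Set ℓ
    IsBijection f a b =
        IsFunctionOn f a
      × (∀ᴰ[ x ] ∀ᴰ[ y ] (Maps f x y → y ∈ b))
      × (∀ᴰ[ x ] ∀ᴰ[ y ] ∀ᴰ[ z ] (Maps f x z → Maps f y z → x ≡ y))
      × (∀ᴰ[ y ] (y ∈ b → ∃ᴰ[ x ] Maps f x y))

    Equinumerous : V → V → Set ℓ
    Equinumerous a b = ∃ᴰ[ f ] IsBijection f a b

    -- Transitive and linearly ordered by ∈; well-foundedness is Foundation.
    IsOrdinal : V → Set ℓ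
    IsOrdinal α =
        (∀ᴰ[ x ] (x ∈ α → x ⊆ α))
      × (∀ᴰ[ x ] ∀ᴰ[ y ] (x ∈ α → y ∈ α → x ∈ y ⊎ x ≡ y ⊎ y ∈ x))

    -- ν = |a|
    IsCardinalityOf : V → V → Set ℓ
    IsCardinalityOf ν a =
        IsOrdinal ν
      × Equinumerous ν a
      × (∀ᴰ[ α ] (α ∈ ν → ¬ Equinumerous α a))

    IsCardinal : V → Set ℓ
    IsCardinal κ = IsCardinalityOf κ κ

    -- |a| < κ
    CardinalityBelow : V → V → Set ℓ
    CardinalityBelow a κ = ∃ᴰ[ ν ] (IsCardinalityOf ν a × ν ∈ κ)

    -- μ = κ⁺
    IsSuccessorCardinal : V → V → Set ℓ
    IsSuccessorCardinal μ κ =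
        IsCardinal μ
      × κ ∈ μ
      × (∀ᴰ[ ν ] (IsCardinal ν → κ ∈ ν → ¬ ν ∈ μ))

    -- μ = 2^κ = |𝒫(κ)|
    IsPowerCardinal : V → V → Set ℓ
    IsPowerCardinal μ κ = ∃ᴰ[ p ] (IsPowerset p κ × IsCardinalityOf μ p)

    -- ZF with Separation and Replacement for formulas with symbols from P.
    record IsZF (P : ℕ → Set ℓ) (I : Interpretation P) : Set ℓ where
      field
        extensionality : ∀ᴰ[ x ] ∀ᴰ[ y ] ((∀ᴰ[ z ] (z ∈ x ⇔ z ∈ y)) → x ≡ y)
        foundation     : ∀ᴰ[ x ] ((∃ᴰ[ y ] y ∈ x) → ∃ᴰ[ y ] (y ∈ x × (∀ᴰ[ z ] (z ∈ x → ¬ z ∈ y))))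
        pairing        : ∀ᴰ[ x ] ∀ᴰ[ y ] ∃ᴰ[ u ] IsUnorderedPair u x y
        union          : ∀ᴰ[ x ] ∃ᴰ[ u ] ∀ᴰ[ z ] (z ∈ u ⇔ (∃ᴰ[ y ] (y ∈ x × z ∈ y)))
        powerset       : ∀ᴰ[ x ] ∃ᴰ[ p ] IsPowerset p x
        infinity       : ∃ᴰ[ w ] ((∃ᴰ[ e ] (IsEmpty e × e ∈ w))
                                 × (∀ᴰ[ x ] (x ∈ w → ∃ᴰ[ s ] (IsSuccessor s x × s ∈ w))))
        separation     : ∀ {n} (φ : Formula P (1+ n)) (ρ : Vec V n) → All D ρ →
                         ∀ᴰ[ a ] ∃ᴰ[ b ] ∀ᴰ[ x ] (x ∈ b ⇔ (x ∈ a × Sat I φ (x ∷ ρ)))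
        replacement    : ∀ {n} (φ : Formula P (1+ (1+ n))) (ρ : Vec V n) → All D ρ →
                         ∀ᴰ[ a ] ((∀ᴰ[ x ] (x ∈ a → ∀ᴰ[ y ] ∀ᴰ[ z ]
                                     (Sat I φ (x ∷ y ∷ ρ) → Sat I φ (x ∷ z ∷ ρ) → y ≡ z)))
                                  → ∃ᴰ[ b ] ∀ᴰ[ y ] (y ∈ b ⇔ (∃ᴰ[ x ] (x ∈ a × Sat I φ (x ∷ y ∷ ρ)))))

    Choice : Set ℓ
    Choice = ∀ᴰ[ a ] ((∀ᴰ[ x ] (x ∈ a → ∃ᴰ[ y ] y ∈ x))
                      → ∃ᴰ[ f ] (IsFunctionOn f a × (∀ᴰ[ x ] ∀ᴰ[ y ] (Maps f x y → y ∈ x))))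

  open Relativized 𝕍

  -- ZFC, with class predicates allowed in Separation and Replacement.
  IsZFC : Set ℓ
  IsZFC = IsZF Cls _∋_ × Choice

  ⟦_⟧ : Cls 1 → V → Set ℓ
  ⟦ C ⟧ x = C ∋ (x ∷ [])

  -- A transitive inner model of ZF.
  record IsInnerModel (M : V → Set ℓ) : Set ℓ where
    field
      transitive : ∀ x y → M x → y ∈ x → M y
      ordinals   : ∀ α → IsOrdinal α → M α
      zf         : Relativized.IsZF M NoSymbols noSymbols

  -- f : D → E is (the restriction to D of) a class function.
  IsClassFunction : (V → Set ℓ) → (V → V) → Set ℓ
  IsClassFunction D f = Σ (Cls 2) λ F → ∀ x y → (F ∋ (x ∷ y ∷ [])) ⇔ (D x × f x ≡ y)

  -- Only the values of f on D matter.
  record IsElementaryEmbedding (D E : V → Set ℓ) (f : V → V) : Set ℓ where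
    field
      isClass    : IsClassFunction D f
      maps       : ∀ x → D x → E (f x)
      elementary : ∀ {n} (φ : Formula NoSymbols n) (ρ : Vec V n) → All D ρ →
                   Relativized.Sat D noSymbols φ ρ ⇔ Relativized.Sat E noSymbols φ (map f ρ)

  -- δ = crit(f), the least ordinal moved by f
  IsCriticalPoint : (V → V) → V → Set ℓ
  IsCriticalPoint f δ = IsOrdinal δ × (∀ α → α ∈ δ → f α ≡ α) × f δ ≢ δ

  -- ᵃM ⊆ M
  ClosedUnderSequences : V → (V → Set ℓ) → Set ℓ
  ClosedUnderSequences a M =
    ∀ f → IsFunctionOn f a → (∀ x y → Maps f x y → M y) → M f

  record NonGalvinEmbeddings (κ : V) (M N : V → Set ℓ) (j i k : V → V) : Set ℓ where
    field
      innerM  : IsInnerModel M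
      innerN  : IsInnerModel N
      embedj  : IsElementaryEmbedding 𝕍 M j
      embedi  : IsElementaryEmbedding 𝕍 N i
      embedk  : IsElementaryEmbedding N M k
      factor  : ∀ x → k (i x) ≡ j x
      critj   : IsCriticalPoint j κ
      critk   : IsCriticalPoint k (i κ)
      closedN : ClosedUnderSequences κ N
      closedM : ClosedUnderSequences κ M
      cover   : ∃ λ κ⁺ → IsSuccessorCardinal κ⁺ κ × (∃ λ A →
                  M A
                × (∀ α → α ∈ κ⁺ → i α ∈ A)
                × Relativized.CardinalityBelow M A (i κ))

  IsNonGalvinCardinal : V → Set ℓ
  IsNonGalvinCardinal κ =
      IsCardinal κ
    × (Σ (Cls 1) λ M → Σ (Cls 1) λ N → ∃ λ j → ∃ λ i → ∃ λ k →
        NonGalvinEmbeddings κ ⟦ M ⟧ ⟦ N ⟧ j i k)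

  record IsUltrafilter (U κ : V) : Set ℓ where
    field
      subsets : ∀ X → X ∈ U → X ⊆ κ
      whole   : κ ∈ U
      proper  : ∀ X → X ∈ U → ¬ IsEmpty X
      upward  : ∀ X Y → X ∈ U → X ⊆ Y → Y ⊆ κ → Y ∈ U
      meet    : ∀ X Y Z → X ∈ U → Y ∈ U → (∀ z → z ∈ Z ⇔ (z ∈ X × z ∈ Y)) → Z ∈ U
      ultra   : ∀ X Y → X ⊆ κ → (∀ z → z ∈ Y ⇔ (z ∈ κ × ¬ z ∈ X)) → X ∈ U ⊎ Y ∈ U

  IsUniform : V → V → Set ℓ
  IsUniform U κ = ∀ X → X ∈ U → IsCardinalityOf κ X

  IsNonprincipal : V → V → Set ℓ
  IsNonprincipal U κ = ¬ (∃ λ x → x ∈ κ × (∀ X → X ∈ U ⇔ (X ⊆ κ × x ∈ X)))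

  -- Closure under intersections, taken inside κ, of fewer than κ members.
  IsComplete : V → V → Set ℓ
  IsComplete U κ =
    ∀ S → S ⊆ U → CardinalityBelow S κ →
    ∃ λ B → B ∈ U × (∀ x → x ∈ B ⇔ (x ∈ κ × (∀ X → X ∈ S → x ∈ X)))

  IsCompleteUltrafilter : V → V → Set ℓ
  IsCompleteUltrafilter U κ = IsUltrafilter U κ × IsNonprincipal U κ × IsComplete U κ

  -- Gal(U , μ , λ) for U over κ; the sequence ⟨A_i⟩_{i<λ} is the function A.
  Gal : V → V → V → V → Set ℓ
  Gal κ U μ l =
    ∀ A → IsFunctionOn A l → (∀ x X → Maps A x X → X ∈ U) →
    ∃ λ I → I ⊆ l × IsCardinalityOf μ I × (∃ λ B →
        B ∈ U
      × (∀ x → x ∈ B ⇔ (x ∈ κ × (∀ ξ X → ξ ∈ I → Maps A ξ X → x ∈ X))))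

  IsNonGalvinUltrafilter : V → V → Set ℓ
  IsNonGalvinUltrafilter U κ =
      IsUltrafilter U κ
    × IsUniform U κ
    × (∃ λ μ → IsPowerCardinal μ κ × ¬ Gal κ U κ μ)

{-# OPTIONS --safe #-}
module Submission where

-- Write λ = i(κ), so that λ < j(κ) and λ is not in the range of j.  Since |A| < λ < j(κ) in M, the set
-- F = A ∩ j(κ) is bounded in j(κ), and the pair ⟨λ , F⟩ belongs to j(W), where W consists of the pairs
-- ⟨ν , F⟩ with ν < κ and F a bounded subset of κ.  Using choice, W is enumerated in order type κ by a
-- function H (no set fixed pointwise by j contains κ many elements), and U is the ultrafilter derived
-- from j and the index η of ⟨λ , F⟩ in j(H).
--
-- Choose injections g_α : α → κ for α < κ⁺ and let A_α be the set of ξ < κ such that H(ξ) = ⟨ν , F⟩ where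
-- the order type of {y < α : g_α(y) < ν} belongs to F.  In M the set {y : j(g_α)(y) < λ} is k″i(α), whose
-- order type is i(α) ∈ A; hence A_α ∈ U.  If e : κ → κ⁺ is injective and the intersection of the A_e(x)
-- belongs to U, then the same computation applied to i(e) gives i(e)(x) ∈ A for all x < λ.  The map
-- x ↦ i(e)(x) belongs to M, where it is computed as an order type, so λ injects into a set of smaller
-- cardinality in M.  But N thinks that λ is a limit cardinal, and k fixes the ordinals below λ, so that
-- M thinks so too: a contradiction.

open import Defs
open import Level using (Level)
open import Axiom.ExcludedMiddle using (ExcludedMiddle)
open import Data.Nat.Base using (ℕ; _+_)
open import Data.Fin.Base using (Fin; zero; suc)
open import Data.Vec.Base using (Vec; []; _∷_; map)
open import Data.Vec.Relation.Unary.All using (All; []; _∷_)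
open import Data.Product.Base using (∃; _×_; _,_; proj₁; proj₂)
open import Data.Sum.Base using (_⊎_; inj₁; inj₂; [_,_]′)
open import Data.Empty using (⊥; ⊥-elim)
open import Function.Bundles using (_⇔_; mk⇔; module Equivalence)
open import Relation.Nullary.Negation.Core using (¬_)
open import Relation.Nullary.Decidable.Core using (Dec; yes; no)
open import Relation.Binary.PropositionalEquality.Core using (_≡_; _≢_; refl; sym; trans; subst; subst₂)

open Equivalence using (to; from)

-- First-order formulas with de Bruijn variables

pattern v0 = zero
pattern v1 = suc v0
pattern v2 = suc v1
pattern v3 = suc v2
pattern v4 = suc v3
pattern v5 = suc v4
pattern v6 = suc v5
pattern v7 = suc v6
pattern v8 = suc v7
pattern v9 = suc v8

-- Formula builders; the truth value of `xᶠ …` computes to the predicate x relativized to the structure at hand.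
module _ {ℓ} {P : ℕ → Set ℓ} {n : ℕ} where

  subsetᶠ : Fin n → Fin n → Formula P n
  subsetᶠ x y = ∀̇ (v0 ∈̇ suc x ⇒̇ v0 ∈̇ suc y)

  upairᶠ : Fin n → Fin n → Fin n → Formula P n
  upairᶠ u x y = ∀̇ (v0 ∈̇ suc u ⇔̇ (v0 ≡̇ suc x ∨̇ v0 ≡̇ suc y))

module _ {ℓ} {P : ℕ → Set ℓ} {n : ℕ} where

  pairᶠ : Fin n → Fin n → Fin n → Formula P n
  pairᶠ p x y = ∃̇ ∃̇ (upairᶠ v1 (suc (suc x)) (suc (suc x))
                   ∧̇ upairᶠ v0 (suc (suc x)) (suc (suc y))
                   ∧̇ upairᶠ (suc (suc p)) v1 v0)

module _ {ℓ} {P : ℕ → Set ℓ} {n : ℕ} where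

  mapsᶠ : Fin n → Fin n → Fin n → Formula P n
  mapsᶠ f x y = ∃̇ (pairᶠ v0 (suc x) (suc y) ∧̇ v0 ∈̇ suc f)

  ∀∈ ∃∈ : Fin n → Formula P (1 + n) → Formula P n
  ∀∈ a φ = ∀̇ (v0 ∈̇ suc a ⇒̇ φ)
  ∃∈ a φ = ∃̇ (v0 ∈̇ suc a ∧̇ φ)

module _ {ℓ} {P : ℕ → Set ℓ} {n : ℕ} where

  ordinalᶠ : Fin n → Formula P n
  ordinalᶠ α = ∀∈ α (subsetᶠ v0 (suc α))
    ∧̇ ∀̇ ∀̇ (v1 ∈̇ suc (suc α) ⇒̇ v0 ∈̇ suc (suc α) ⇒̇ v1 ∈̇ v0 ∨̇ v1 ≡̇ v0 ∨̇ v0 ∈̇ v1)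

-- Elementary set theory from the axioms

module SetTheory {ℓ} (em : ExcludedMiddle ℓ) (𝒰 : Universe ℓ) (zfc : IsZFC 𝒰) where
  open Universe 𝒰
  open Relativized 𝒰 (𝕍 𝒰)
  open IsZF (proj₁ zfc)

  Truth : ∀ {n} → Formula Cls n → Vec V n → Set ℓ
  Truth = Sat _∋_

  all𝕍 : ∀ {n} (ρ : Vec V n) → All (𝕍 𝒰) ρ
  all𝕍 []      = []
  all𝕍 (_ ∷ ρ) = _ ∷ all𝕍 ρ

  byContradiction : {Q : Set ℓ} → (¬ Q → ⊥) → Q
  byContradiction {Q} h with em {Q}
  ... | yes q = q
  ... | no ¬q = ⊥-elim (h ¬q)

  ext : ∀ {x y} → (∀ z → z ∈ x → z ∈ y) → (∀ z → z ∈ y → z ∈ x) → x ≡ y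
  ext p q = extensionality _ _ _ _ λ z _ → mk⇔ (p z) (q z)

  abstract
    sep : ∀ {n} (φ : Formula Cls (1 + n)) (ρ : Vec V n) (a : V) →
          ∃ λ b → ∀ x → x ∈ b ⇔ (x ∈ a × Truth φ (x ∷ ρ))
    sep φ ρ a with separation φ ρ (all𝕍 ρ) a _
    ... | b , _ , h = b , λ x → h x _

  abstract
    -- Foundation applied to the set of solutions in `a`. The transfinite inductions below run
    -- through a minimal counterexample obtained here, so the property in question has to be
    -- expressed by a formula.
    least : ∀ {n} (φ : Formula Cls (1 + n)) (ρ : Vec V n) (a : V) {x : V} → x ∈ a → Truth φ (x ∷ ρ) →
            ∃ λ m → m ∈ a × Truth φ (m ∷ ρ) × (∀ y → y ∈ a → Truth φ (y ∷ ρ) → ¬ y ∈ m)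
    least φ ρ a {x} x∈a t with sep φ ρ a
    ... | b , hb with foundation b _ (x , _ , from (hb x) (x∈a , t))
    ... | m , _ , m∈b , min =
      m , proj₁ (to (hb m) m∈b) , proj₂ (to (hb m) m∈b) , λ y y∈a ty → min y _ (from (hb y) (y∈a , ty))

  abstract
    upair : ∀ x y → ∃ λ u → ∀ z → z ∈ u ⇔ (z ≡ x ⊎ z ≡ y)
    upair x y with pairing x _ y _
    ... | u , _ , h = u , λ z → h z _

  abstract
    ∈-asym : ∀ {x y} → x ∈ y → ¬ y ∈ x
    ∈-asym {x} {y} p q with upair x y
    ... | u , hu with foundation u _ (x , _ , from (hu x) (inj₁ refl))
    ... | m , _ , m∈u , min with to (hu m) m∈u
    ... | inj₁ refl = min y _ (from (hu y) (inj₂ refl)) q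
    ... | inj₂ refl = min x _ (from (hu x) (inj₁ refl)) p

  ∈-irrefl : ∀ {x} → ¬ x ∈ x
  ∈-irrefl p = ∈-asym p p

  abstract
    pow : ∀ a → ∃ λ p → ∀ x → x ∈ p ⇔ x ⊆ a
    pow a with powerset a _
    ... | p , _ , h = p , λ x → h x _

  abstract
    pair-exists : ∀ x y → ∃ λ p → IsOrderedPair p x y
    pair-exists x y with upair x x | upair x y
    ... | s , hs | t , ht with upair s t
    ... | p , hp = p , s , _ , t , _ , (λ z _ → hs z) , (λ z _ → ht z) , λ z _ → hp z

  upair-unique : ∀ {u v x y} → IsUnorderedPair u x y → IsUnorderedPair v x y → u ≡ v
  upair-unique hu hv = ext (λ z p → from (hv z _) (to (hu z _) p)) (λ z p → from (hu z _) (to (hv z _) p))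

  abstract
    pair-unique : ∀ {p q x y} → IsOrderedPair p x y → IsOrderedPair q x y → p ≡ q
    pair-unique (s , _ , t , _ , hs , ht , hp) (s′ , _ , t′ , _ , hs′ , ht′ , hq)
      with upair-unique hs hs′ | upair-unique ht ht′
    ... | refl | refl = upair-unique hp hq

  abstract
    pair-injˡ : ∀ {p x y x′ y′} → IsOrderedPair p x y → IsOrderedPair p x′ y′ → x ≡ x′
    pair-injˡ {x′ = x′} (s , _ , t , _ , hs , ht , hp) (s′ , _ , t′ , _ , hs′ , ht′ , hq)
      with to (hq s _) (from (hp s _) (inj₁ refl))
    ... | inj₁ refl with to (hs x′ _) (from (hs′ x′ _) (inj₁ refl))
    ...   | inj₁ e = sym e
    ...   | inj₂ e = sym e
    pair-injˡ {x′ = x′} (s , _ , t , _ , hs , ht , hp) (s′ , _ , t′ , _ , hs′ , ht′ , hq)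
        | inj₂ refl with to (hs x′ _) (from (ht′ x′ _) (inj₁ refl))
    ...   | inj₁ e = sym e
    ...   | inj₂ e = sym e

  abstract
    pair-injʳ : ∀ {p x y x′ y′} → IsOrderedPair p x y → IsOrderedPair p x′ y′ → y ≡ y′
    pair-injʳ {x = x} {y} {y′ = y′} P P′ with pair-injˡ P P′ | em {y ≡ x}
    pair-injʳ {x = x} {y} {y′ = y′} (s , _ , t , _ , hs , ht , hp) (s′ , _ , t′ , _ , hs′ , ht′ , hq)
        | refl | yes refl with to (hp t′ _) (from (hq t′ _) (inj₂ refl))
    ... | inj₁ refl with to (hs y′ _) (from (ht′ y′ _) (inj₂ refl))
    ...   | inj₁ e = sym e
    ...   | inj₂ e = sym e
    pair-injʳ {x = x} {y} {y′ = y′} (s , _ , t , _ , hs , ht , hp) (s′ , _ , t′ , _ , hs′ , ht′ , hq)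
        | refl | yes refl | inj₂ refl with to (ht y′ _) (from (ht′ y′ _) (inj₂ refl))
    ...   | inj₁ e = sym e
    ...   | inj₂ e = sym e
    pair-injʳ {x = x} {y} {y′ = y′} (s , _ , t , _ , hs , ht , hp) (s′ , _ , t′ , _ , hs′ , ht′ , hq)
        | refl | no y≢x with to (hq t _) (from (hp t _) (inj₂ refl))
    ... | inj₁ refl with to (hs′ y _) (from (ht y _) (inj₂ refl))
    ...   | inj₁ e = ⊥-elim (y≢x e)
    ...   | inj₂ e = ⊥-elim (y≢x e)
    pair-injʳ {x = x} {y} {y′ = y′} (s , _ , t , _ , hs , ht , hp) (s′ , _ , t′ , _ , hs′ , ht′ , hq)
        | refl | no y≢x | inj₂ refl with to (ht′ y _) (from (ht y _) (inj₂ refl))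
    ...   | inj₁ e = ⊥-elim (y≢x e)
    ...   | inj₂ e = e

  abstract
    -- By Kuratowski's coding the pairs lie in the double power set of `a ∪ b`, so relations can be
    -- cut out by Separation.
    pair-bound : ∀ a b → ∃ λ c → ∀ {p x y} → x ∈ a → y ∈ b → IsOrderedPair p x y → p ∈ c
    pair-bound a b with upair a b
    ... | d , hd with union d _
    ... | u , _ , hu with pow u
    ... | pu , hpu with pow pu
    ... | c , hc = c , bound
      where
      inˡ : ∀ {x} → x ∈ a → x ∈ u
      inˡ {x} x∈a = from (hu x _) (a , _ , from (hd a) (inj₁ refl) , x∈a)
      inʳ : ∀ {x} → x ∈ b → x ∈ u
      inʳ {x} x∈b = from (hu x _) (b , _ , from (hd b) (inj₂ refl) , x∈b)
      sub : ∀ {v x y} → x ∈ u → y ∈ u → IsUnorderedPair v x y → v ∈ pu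
      sub {v} {x} {y} x∈u y∈u hv = from (hpu v) λ z _ z∈v → case z (to (hv z _) z∈v)
        where
        case : ∀ z → (z ≡ x ⊎ z ≡ y) → z ∈ u
        case z (inj₁ refl) = x∈u
        case z (inj₂ refl) = y∈u
      bound : ∀ {p x y} → x ∈ a → y ∈ b → IsOrderedPair p x y → p ∈ c
      bound {p} x∈a y∈b (s , _ , t , _ , hs , ht , hp) = from (hc p) λ z _ z∈p → case z (to (hp z _) z∈p)
        where
        case : ∀ z → (z ≡ s ⊎ z ≡ t) → z ∈ pu
        case z (inj₁ refl) = sub (inˡ x∈a) (inˡ x∈a) hs
        case z (inj₂ refl) = sub (inˡ x∈a) (inʳ y∈b) ht

  -- A set that realizes the metatheoretic relation `Q` on `a × b`. Values are accessed through
  -- `inv` and `intro`, so that Kuratowski pairs rarely have to be unpacked again.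
  record Graph (a b : V) (Q : V → V → Set ℓ) : Set ℓ where
    field
      graph : V
      pairs : ∀ p → p ∈ graph → ∃ λ x → ∃ λ y → x ∈ a × y ∈ b × IsOrderedPair p x y
      inv   : ∀ {x y} → Maps graph x y → x ∈ a × y ∈ b × Q x y
      intro : ∀ {x y} → x ∈ a → y ∈ b → Q x y → Maps graph x y

  -- In θ the variables 0, 1 are y, x; variable 2 is the pair itself and should not be used.
  abstract
    comp : ∀ {n} (a b : V) (Q : V → V → Set ℓ) (θ : Formula Cls (5 + n)) (ρ : Vec V n) →
           (∀ y x p → Truth θ (y ∷ x ∷ p ∷ a ∷ b ∷ ρ) ≡ Q x y) → Graph a b Q
    comp a b Q θ ρ eq with pair-bound a b
    ... | c , hc with sep (∃̇ ∃̇ (pairᶠ v2 v1 v0 ∧̇ v1 ∈̇ v3 ∧̇ v0 ∈̇ v4 ∧̇ θ)) (a ∷ b ∷ ρ) c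
    ... | R , hR = record
      { graph = R
      ; pairs = λ p p∈R → case p (proj₂ (to (hR p) p∈R))
      ; inv   = λ { (p , _ , P , p∈R) → case′ P (proj₂ (to (hR p) p∈R)) }
      ; intro = λ {x} {y} x∈a y∈b q → case″ x∈a y∈b q (pair-exists x y)
      }
      where
      case : ∀ p → Truth (∃̇ ∃̇ (pairᶠ v2 v1 v0 ∧̇ v1 ∈̇ v3 ∧̇ v0 ∈̇ v4 ∧̇ θ)) (p ∷ a ∷ b ∷ ρ) →
             ∃ λ x → ∃ λ y → x ∈ a × y ∈ b × IsOrderedPair p x y
      case p (x , _ , y , _ , P , x∈a , y∈b , _) = x , y , x∈a , y∈b , P
      case′ : ∀ {p x y} → IsOrderedPair p x y →
              Truth (∃̇ ∃̇ (pairᶠ v2 v1 v0 ∧̇ v1 ∈̇ v3 ∧̇ v0 ∈̇ v4 ∧̇ θ)) (p ∷ a ∷ b ∷ ρ) → x ∈ a × y ∈ b × Q x y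
      case′ {p} P (x′ , _ , y′ , _ , P′ , x∈a , y∈b , t) with pair-injˡ P P′ | pair-injʳ P P′
      ... | refl | refl = x∈a , y∈b , subst (λ X → X) (eq _ _ _) t
      case″ : ∀ {x y} → x ∈ a → y ∈ b → Q x y → ∃ (λ p → IsOrderedPair p x y) → Maps R x y
      case″ {x} {y} x∈a y∈b q (p , P) =
        p , _ , P , from (hR p) (hc x∈a y∈b P , x , _ , y , _ , P , x∈a , y∈b , subst (λ X → X) (sym (eq _ _ _)) q)

  abstract
    -- The set {x, y, z}, formed as the union of {{x, y}, {z}}, would have no minimal element.
    ∈-no3cycle : ∀ {x y z} → x ∈ y → y ∈ z → ¬ z ∈ x
    ∈-no3cycle {x} {y} {z} p q r with upair x y | upair z z
    ... | u , hu | w , hw with upair u w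
    ... | d , hd with union d _
    ... | t , _ , ht with foundation t _ (x , _ , from (ht x _) (u , _ , from (hd u) (inj₁ refl) , from (hu x) (inj₁ refl)))
    ... | m , _ , m∈t , min with to (ht m _) m∈t
    ... | v , _ , v∈d , m∈v with to (hd v) v∈d
    ... | inj₂ refl with to (hw m) m∈v
    ...   | inj₁ refl = min y _ (from (ht y _) (u , _ , from (hd u) (inj₁ refl) , from (hu y) (inj₂ refl))) q
    ...   | inj₂ refl = min y _ (from (ht y _) (u , _ , from (hd u) (inj₁ refl) , from (hu y) (inj₂ refl))) q
    ∈-no3cycle {x} {y} {z} p q r | u , hu | w , hw | d , hd | t , _ , ht | m , _ , m∈t , min | v , _ , v∈d , m∈v
        | inj₁ refl with to (hu m) m∈v
    ...   | inj₁ refl = min z _ (from (ht z _) (w , _ , from (hd w) (inj₂ refl) , from (hw z) (inj₁ refl))) r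
    ...   | inj₂ refl = min x _ (from (ht x _) (u , _ , from (hd u) (inj₁ refl) , from (hu x) (inj₁ refl))) p

  -- Ordinals

  ord-trans : ∀ {α x z} → IsOrdinal α → x ∈ α → z ∈ x → z ∈ α
  ord-trans (t , _) x∈α z∈x = t _ _ x∈α _ _ z∈x

  ord-lin : ∀ {α x y} → IsOrdinal α → x ∈ α → y ∈ α → x ∈ y ⊎ x ≡ y ⊎ y ∈ x
  ord-lin (_ , l) x∈α y∈α = l _ _ _ _ x∈α y∈α

  ord-elem : ∀ {α x} → IsOrdinal α → x ∈ α → IsOrdinal x
  ord-elem {α} {x} o x∈α = (λ y _ y∈x z _ z∈y → case y z y∈x z∈y) ,
      λ y _ z _ y∈x z∈x → ord-lin o (ord-trans o x∈α y∈x) (ord-trans o x∈α z∈x)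
    where
    case : ∀ y z → y ∈ x → z ∈ y → z ∈ x
    case y z y∈x z∈y with ord-lin o (ord-trans o (ord-trans o x∈α y∈x) z∈y) x∈α
    ... | inj₁ z∈x         = z∈x
    ... | inj₂ (inj₁ refl) = ⊥-elim (∈-asym y∈x z∈y)
    ... | inj₂ (inj₂ x∈z)  = ⊥-elim (∈-no3cycle x∈z z∈y y∈x)

  abstract
    -- If `β` is a proper subset, the least element of `α` outside `β` has exactly the elements of
    -- `β`, hence equals it.
    transitive-subset : ∀ {α β} → IsOrdinal α → (∀ {x z} → x ∈ β → z ∈ x → z ∈ β) →
                        (∀ {x} → x ∈ β → x ∈ α) → β ∈ α ⊎ β ≡ α
    transitive-subset {α} {β} o tβ β⊆α with em {∃ λ x → x ∈ α × ¬ x ∈ β}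
    ... | no h = inj₂ (ext (λ _ → β⊆α) λ x x∈α → byContradiction λ x∉β → h (x , x∈α , x∉β))
    ... | yes (x , x∈α , x∉β) with least (¬̇ (v0 ∈̇ v1)) (β ∷ []) α x∈α x∉β
    ... | m , m∈α , m∉β , min = inj₁ (subst (_∈ α) (ext m⊆β β⊆m) m∈α)
      where
      m⊆β : ∀ z → z ∈ m → z ∈ β
      m⊆β z z∈m = byContradiction λ z∉β → min z (ord-trans o m∈α z∈m) z∉β z∈m
      β⊆m : ∀ z → z ∈ β → z ∈ m
      β⊆m z z∈β with ord-lin o (β⊆α z∈β) m∈α
      ... | inj₁ z∈m         = z∈m
      ... | inj₂ (inj₁ refl) = ⊥-elim (m∉β z∈β)
      ... | inj₂ (inj₂ m∈z)  = ⊥-elim (m∉β (tβ z∈β m∈z))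

  abstract
    -- The intersection `γ` is an initial segment of both; were it an element of both, it would
    -- belong to itself.
    trichotomy : ∀ {α β} → IsOrdinal α → IsOrdinal β → α ∈ β ⊎ α ≡ β ⊎ β ∈ α
    trichotomy {α} {β} oα oβ with sep (v0 ∈̇ v1) (β ∷ []) α
    ... | γ , hγ with transitive-subset oα γ-trans (λ x∈γ → proj₁ (to (hγ _) x∈γ))
                    | transitive-subset oβ γ-trans (λ x∈γ → proj₂ (to (hγ _) x∈γ))
      where
      γ-trans : ∀ {x z} → x ∈ γ → z ∈ x → z ∈ γ
      γ-trans x∈γ z∈x with to (hγ _) x∈γ
      ... | x∈α , x∈β = from (hγ _) (ord-trans oα x∈α z∈x , ord-trans oβ x∈β z∈x)
    ... | inj₁ γ∈α  | inj₁ γ∈β  = ⊥-elim (∈-irrefl (from (hγ _) (γ∈α , γ∈β)))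
    ... | inj₁ γ∈α  | inj₂ refl = inj₂ (inj₂ γ∈α)
    ... | inj₂ refl | inj₁ γ∈β  = inj₁ γ∈β
    ... | inj₂ refl | inj₂ e    = inj₂ (inj₁ e)

  -- Functions as sets of pairs, and transfinite recursion

  Functional Injective : V → Set ℓ
  Functional g = ∀ {x y z} → Maps g x y → Maps g x z → y ≡ z
  Injective g  = ∀ {x y z} → Maps g x z → Maps g y z → x ≡ y

  IsImage : V → V → V → Set ℓ
  IsImage s h x = ∀ᴰ[ z ] (z ∈ s ⇔ (∃ᴰ[ u ] (u ∈ x × Maps h u z)))

  imageᶠ : ∀ {n} → Fin n → Fin n → Fin n → Formula Cls n
  imageᶠ s h x = ∀̇ (v0 ∈̇ suc s ⇔̇ ∃∈ (suc x) (mapsᶠ (suc (suc h)) v0 v1))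

  abstract
    image-exists : ∀ {W h} x → (∀ {u z} → Maps h u z → z ∈ W) → ∃ λ s → IsImage s h x
    image-exists {W} {h} x ran with sep (∃∈ v1 (mapsᶠ v3 v0 v1)) (x ∷ h ∷ []) W
    ... | s , hs = s , λ z _ → mk⇔ (λ z∈s → proj₂ (to (hs z) z∈s))
                                   λ { (u , _ , u∈x , m) → from (hs z) (ran m , u , _ , u∈x , m) }

  -- The solution H of H(β) = G({H(γ) : γ ∈ β}) for β ∈ bound, continued as long as G is defined.
  record Recursion (bound G : V) : Set ℓ where
    field
      dom      : V
      H        : V
      dom-tr   : ∀ {x z} → x ∈ dom → z ∈ x → z ∈ dom
      dom-le   : dom ∈ bound ⊎ dom ≡ bound
      H-dom    : ∀ {x y} → Maps H x y → x ∈ dom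
      H-total  : ∀ {x} → x ∈ dom → ∃ λ y → Maps H x y
      H-fun    : Functional H
      H-inj    : Injective H
      H-step   : ∀ {x y} → Maps H x y → ∃ λ s → IsImage s H x × Maps G s y
      stuck    : dom ≡ bound ⊎ (∀ s y → IsImage s H dom → ¬ Maps G s y)

  module RecursionTheorem (bound W G : V) (o : IsOrdinal bound) (G-fun : Functional G)
           (G-ran : ∀ {s y} → Maps G s y → y ∈ W × ¬ y ∈ s) where

    -- An approximation to the solution: `p` obeys the recursion on a transitive domain `α`.
    -- Single-valuedness comes from `attempts-agree`, taken with both attempts equal.
    Attempt : V → V → Set ℓ
    Attempt α p =
        (∀ᴰ[ x ] (x ∈ α → x ⊆ α))
      × (∀ᴰ[ x ] ∀ᴰ[ y ] (Maps p x y → x ∈ α))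
      × (∀ᴰ[ x ] (x ∈ α → ∃ᴰ[ y ] Maps p x y))
      × (∀ᴰ[ x ] ∀ᴰ[ y ] (Maps p x y → ∃ᴰ[ s ] (IsImage s p x × Maps G s y)))

    attemptᶠ : ∀ {n} → Fin n → Fin n → Fin n → Formula Cls n
    attemptᶠ g α p =
         ∀∈ α (subsetᶠ v0 (suc α))
      ∧̇ (∀̇ ∀̇ (mapsᶠ (suc (suc p)) v1 v0 ⇒̇ v1 ∈̇ suc (suc α)))
      ∧̇ ∀∈ α (∃̇ mapsᶠ (suc (suc p)) v1 v0)
      ∧̇ (∀̇ ∀̇ (mapsᶠ (suc (suc p)) v1 v0 ⇒̇ ∃̇ (imageᶠ v0 (suc (suc (suc p))) v2 ∧̇ mapsᶠ (suc (suc (suc g))) v0 v1)))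

    abstract
      -- At the least point of disagreement the two attempts have the same image below it, and `G`
      -- is single-valued.
      attempts-agree : ∀ {α p β q x y y′} → Attempt α p → Attempt β q → Maps p x y → Maps q x y′ → y ≡ y′
      attempts-agree {α} {p} {β} {q} {x} {y} {y′} (tα , dα , eα , sα) (tβ , dβ , eβ , sβ) m m′ =
        byContradiction λ y≢y′ → go (least (∃̇ ∃̇ (mapsᶠ v3 v2 v1 ∧̇ mapsᶠ v4 v2 v0 ∧̇ ¬̇ (v1 ≡̇ v0))) (p ∷ q ∷ []) α
          (dα _ _ _ _ m) (y , _ , y′ , _ , m , m′ , y≢y′))
        where
        Disagree : V → Set ℓ
        Disagree u = ∃ᴰ[ z ] ∃ᴰ[ z′ ] (Maps p u z × Maps q u z′ × ¬ z ≡ z′)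
        go : (∃ λ m → m ∈ α × Disagree m × (∀ u → u ∈ α → Disagree u → ¬ u ∈ m)) → ⊥
        go (x , x∈α , (y , _ , y′ , _ , m , m′ , y≢y′) , min) with sα _ _ _ _ m | sβ _ _ _ _ m′
        ... | s , _ , hs , g | s′ , _ , hs′ , g′ =
            y≢y′ (G-fun g (subst (λ s → Maps G s y′) (sym (ext s⊆s′ s′⊆s)) g′))
          where
          agree : ∀ {u z z′} → u ∈ x → Maps p u z → Maps q u z′ → z ≡ z′
          agree {u} {z} {z′} u∈x a b = byContradiction λ z≢z′ →
            min u (tα _ _ x∈α _ _ u∈x) (z , _ , z′ , _ , a , b , z≢z′) u∈x
          s⊆s′ : ∀ z → z ∈ s → z ∈ s′
          s⊆s′ z z∈s with to (hs z _) z∈s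
          ... | u , _ , u∈x , a with eβ u _ (tβ _ _ (dβ _ _ _ _ m′) _ _ u∈x)
          ... | z′ , _ , b with agree u∈x a b
          ... | refl = from (hs′ z _) (u , _ , u∈x , b)
          s′⊆s : ∀ z → z ∈ s′ → z ∈ s
          s′⊆s z z∈s′ with to (hs′ z _) z∈s′
          ... | u , _ , u∈x , b with eα u _ (tα _ _ x∈α _ _ u∈x)
          ... | z′ , _ , a with agree u∈x a b
          ... | refl = from (hs z _) (u , _ , u∈x , a)

    Approximated : V → V → Set ℓ
    Approximated x y = ∃ᴰ[ α ] ∃ᴰ[ p ] (Attempt α p × Maps p x y)

    private
      abstract
        solution : Graph bound W Approximated
        solution = comp bound W Approximated (∃̇ ∃̇ (attemptᶠ v7 v1 v0 ∧̇ mapsᶠ v0 v3 v2)) (G ∷ []) λ _ _ _ → refl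
      open Graph solution renaming (graph to H)

      abstract
        domain : ∃ λ δ → ∀ x → x ∈ δ ⇔ (x ∈ bound × (∃ᴰ[ y ] Maps H x y))
        domain = sep (∃̇ mapsᶠ v2 v1 v0) (H ∷ []) bound
      δ = proj₁ domain

      attempt-ran : ∀ {α p x y} → Attempt α p → Maps p x y → y ∈ W
      attempt-ran (_ , _ , _ , st) m with st _ _ _ _ m
      ... | _ , _ , _ , g = proj₁ (G-ran g)

      H-intro : ∀ {α p x y} → Attempt α p → x ∈ bound → Maps p x y → Maps H x y
      H-intro at x∈b m = intro x∈b (attempt-ran at m) (_ , _ , _ , _ , at , m)

      H-fun : Functional H
      H-fun m m′ with proj₂ (proj₂ (inv m)) | proj₂ (proj₂ (inv m′))
      ... | _ , _ , _ , _ , at , a | _ , _ , _ , _ , at′ , a′ = attempts-agree at at′ a a′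

      H-down : ∀ {x y u} → Maps H x y → u ∈ x → ∃ λ z → Maps H u z
      H-down m u∈x with inv m
      ... | x∈b , _ , α , _ , p , _ , at@(tα , dα , eα , _) , a with eα _ _ (tα _ _ (dα _ _ _ _ a) _ _ u∈x)
      ... | z , _ , b = z , H-intro at (ord-trans o x∈b u∈x) b

      H-step : ∀ {x y} → Maps H x y → ∃ λ s → IsImage s H x × Maps G s y
      H-step {x} m with inv m
      ... | x∈b , _ , α , _ , p , _ , at@(tα , dα , eα , sα) , a with sα _ _ _ _ a
      ... | s , _ , hs , g = s , (λ z _ → mk⇔ (fw z) (bw z)) , g
        where
        fw : ∀ z → z ∈ s → ∃ᴰ[ u ] (u ∈ x × Maps H u z)
        fw z z∈s with to (hs z _) z∈s
        ... | u , _ , u∈x , c = u , _ , u∈x , H-intro at (ord-trans o x∈b u∈x) c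
        bw : ∀ z → ∃ᴰ[ u ] (u ∈ x × Maps H u z) → z ∈ s
        bw z (u , _ , u∈x , c) with eα _ _ (tα _ _ (dα _ _ _ _ a) _ _ u∈x)
        ... | z′ , _ , b with H-fun c (H-intro at (ord-trans o x∈b u∈x) b)
        ... | refl = from (hs z _) (u , _ , u∈x , b)

      δ-tr : ∀ {x z} → x ∈ δ → z ∈ x → z ∈ δ
      δ-tr x∈δ z∈x with to (proj₂ domain _) x∈δ
      ... | x∈b , _ , _ , m with H-down m z∈x
      ... | w , m′ = from (proj₂ domain _) (ord-trans o x∈b z∈x , w , _ , m′)

      -- By `G-ran` each step produces something outside the set of earlier values.
      H-ne : ∀ {x x′ y} → x ∈ x′ → Maps H x y → ¬ Maps H x′ y
      H-ne x∈x′ m m′ with H-step m′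
      ... | s , hs , g = proj₂ (G-ran g) (from (hs _ _) (_ , _ , x∈x′ , m))

      H-inj : Injective H
      H-inj m m′ with ord-lin o (proj₁ (inv m)) (proj₁ (inv m′))
      ... | inj₁ p        = ⊥-elim (H-ne p m m′)
      ... | inj₂ (inj₁ e) = e
      ... | inj₂ (inj₂ p) = ⊥-elim (H-ne p m′ m)

      H-dom : ∀ {x y} → Maps H x y → x ∈ δ
      H-dom m = from (proj₂ domain _) (proj₁ (inv m) , _ , _ , m)

      -- If `G` had a value at the image of `δ`, adding this value at `δ` would give an attempt with
      -- `δ` in its domain, and `δ` would be an element of itself.
      stuck : δ ∈ bound → ∀ s y → IsImage s H δ → ¬ Maps G s y
      stuck δ∈b s y hs g = ∈-irrefl (H-dom (H-intro at δ∈b (intro′ δ∈b y∈W (inj₂ (refl , refl)))))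
        where
        y∈W : y ∈ W
        y∈W = proj₁ (G-ran g)
        extended : Graph bound W (λ x z → Maps H x z ⊎ (x ≡ δ × z ≡ y))
        extended = comp bound W _ (mapsᶠ v5 v1 v0 ∨̇ (v1 ≡̇ v6 ∧̇ v0 ≡̇ v7)) (H ∷ δ ∷ y ∷ []) λ _ _ _ → refl
        open Graph extended using () renaming (graph to p; inv to inv′; intro to intro′)
        δ⁺ : ∃ λ a → ∀ x → x ∈ a ⇔ (x ∈ bound × (x ∈ δ ⊎ x ≡ δ))
        δ⁺ = sep (v0 ∈̇ v1 ∨̇ v0 ≡̇ v1) (δ ∷ []) bound
        below : ∀ {x} → x ∈ δ → x ∈ proj₁ δ⁺
        below x∈δ = from (proj₂ δ⁺ _) (proj₁ (to (proj₂ domain _) x∈δ) , inj₁ x∈δ)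
        old : ∀ {x z} → Maps H x z → Maps p x z
        old m with inv m
        ... | a , b , _ = intro′ a b (inj₁ m)
        -- The added pair sits at `δ`, which is not an element of any `x ≤ δ`, so the images that
        -- the recursion consults are unchanged.
        small : ∀ {x u z} → x ∈ δ ⊎ x ≡ δ → u ∈ x → Maps p u z → Maps H u z
        small x≤δ u∈x m with proj₂ (proj₂ (inv′ m))
        ... | inj₁ m′ = m′
        small (inj₁ x∈δ) u∈x m  | inj₂ (refl , refl) = ⊥-elim (∈-asym x∈δ u∈x)
        small (inj₂ refl) u∈x m | inj₂ (refl , refl) = ⊥-elim (∈-irrefl u∈x)
        restrict : ∀ {x t} → x ∈ δ ⊎ x ≡ δ → IsImage t H x → IsImage t p x
        restrict x≤δ ht z _ = mk⇔
          (λ z∈t → case z (to (ht z _) z∈t))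
          λ { (u , _ , u∈x , m) → from (ht z _) (u , _ , u∈x , small x≤δ u∈x m) }
          where
          case : ∀ z → ∃ᴰ[ u ] (u ∈ _ × Maps H u z) → ∃ᴰ[ u ] (u ∈ _ × Maps p u z)
          case z (u , _ , u∈x , m) = u , _ , u∈x , old m
        at : Attempt (proj₁ δ⁺) p
        at = (λ x _ x∈ z _ z∈x → tr (proj₂ (to (proj₂ δ⁺ x) x∈)) z∈x)
           , (λ x _ z _ m → dm (proj₂ (proj₂ (inv′ m))))
           , (λ x _ x∈ → tot (proj₂ (to (proj₂ δ⁺ x) x∈)))
           , (λ x _ z _ m → st (proj₂ (proj₂ (inv′ m))))
          where
          tr : ∀ {x z} → x ∈ δ ⊎ x ≡ δ → z ∈ x → z ∈ proj₁ δ⁺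
          tr (inj₁ x∈δ)  z∈x = below (δ-tr x∈δ z∈x)
          tr (inj₂ refl) z∈x = below z∈x
          dm : ∀ {x z} → Maps H x z ⊎ (x ≡ δ × z ≡ y) → x ∈ proj₁ δ⁺
          dm (inj₁ m)             = below (H-dom m)
          dm (inj₂ (refl , refl)) = from (proj₂ δ⁺ _) (δ∈b , inj₂ refl)
          tot : ∀ {x} → x ∈ δ ⊎ x ≡ δ → ∃ᴰ[ z ] Maps p x z
          tot (inj₁ x∈δ) with to (proj₂ domain _) x∈δ
          ... | _ , z , _ , m = z , _ , old m
          tot (inj₂ refl) = y , _ , intro′ δ∈b y∈W (inj₂ (refl , refl))
          st : ∀ {x z} → Maps H x z ⊎ (x ≡ δ × z ≡ y) → ∃ᴰ[ t ] (IsImage t p x × Maps G t z)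
          st (inj₁ m) with H-step m
          ... | t , ht , g′ = t , _ , restrict (inj₁ (H-dom m)) ht , g′
          st (inj₂ (refl , refl)) = s , _ , restrict (inj₂ refl) hs , g

      dom-le : δ ∈ bound ⊎ δ ≡ bound
      dom-le = transitive-subset o δ-tr λ x∈δ → proj₁ (to (proj₂ domain _) x∈δ)

    abstract
      recursion : Recursion bound G
      recursion = record
        { dom = δ ; H = H ; dom-tr = δ-tr ; dom-le = dom-le ; H-dom = H-dom
        ; H-total = λ x∈δ → let (_ , y , _ , m) = to (proj₂ domain _) x∈δ in y , m
        ; H-fun = H-fun ; H-inj = H-inj ; H-step = H-step ; stuck = case dom-le }
        where
        case : δ ∈ bound ⊎ δ ≡ bound → δ ≡ bound ⊎ (∀ s y → IsImage s H δ → ¬ Maps G s y)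
        case (inj₁ δ∈b) = inj₂ (stuck δ∈b)
        case (inj₂ e)   = inj₁ e

-- Predicates that have to be evaluated in M and N as well as in V.
module On {ℓ} (𝒰 : Universe ℓ) (D : Universe.V 𝒰 → Set ℓ) where
  open Universe 𝒰
  open Relativized 𝒰 D

  Functionalᴰ Injectiveᴰ : V → Set ℓ
  Functionalᴰ g = ∀ᴰ[ x ] ∀ᴰ[ y ] ∀ᴰ[ z ] (Maps g x y → Maps g x z → y ≡ z)
  Injectiveᴰ g  = ∀ᴰ[ x ] ∀ᴰ[ y ] ∀ᴰ[ z ] (Maps g x z → Maps g y z → x ≡ y)

  IsInjectionᴰ : V → V → V → Set ℓ
  IsInjectionᴰ g a b =
      Functionalᴰ g
    × Injectiveᴰ g
    × (∀ᴰ[ x ] ∀ᴰ[ y ] (Maps g x y → x ∈ a × y ∈ b))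
    × (∀ᴰ[ x ] (x ∈ a → ∃ᴰ[ y ] Maps g x y))

  IsOrderTypeᴰ : V → V → V → V → Set ℓ
  IsOrderTypeᴰ h δ g ν =
      (∀ᴰ[ x ] (x ∈ δ → x ⊆ δ))
    × Functionalᴰ h
    × Injectiveᴰ h
    × (∀ᴰ[ x ] (x ∈ δ → ∃ᴰ[ y ] ∃ᴰ[ z ] (Maps h x y × Maps g y z × z ∈ ν)))
    × (∀ᴰ[ y ] ∀ᴰ[ z ] (Maps g y z → z ∈ ν → ∃ᴰ[ x ] (x ∈ δ × Maps h x y)))
    × (∀ᴰ[ x ] ∀ᴰ[ y ] ∀ᴰ[ u ] ∀ᴰ[ v ] (x ∈ δ → y ∈ δ → Maps h x u → Maps h y v → x ∈ y ⇔ u ∈ v))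

module _ {ℓ} {P : ℕ → Set ℓ} {n : ℕ} where

  functionalᶠ injectiveᶠ : Fin n → Formula P n
  functionalᶠ g = ∀̇ ∀̇ ∀̇ (mapsᶠ (suc (suc (suc g))) v2 v1 ⇒̇ mapsᶠ (suc (suc (suc g))) v2 v0 ⇒̇ v1 ≡̇ v0)
  injectiveᶠ g  = ∀̇ ∀̇ ∀̇ (mapsᶠ (suc (suc (suc g))) v2 v0 ⇒̇ mapsᶠ (suc (suc (suc g))) v1 v0 ⇒̇ v2 ≡̇ v1)

module _ {ℓ} {P : ℕ → Set ℓ} {n : ℕ} where

  isInjectionᶠ : Fin n → Fin n → Fin n → Formula P n
  isInjectionᶠ g a b =
       functionalᶠ g
    ∧̇ injectiveᶠ g
    ∧̇ (∀̇ ∀̇ (mapsᶠ (suc (suc g)) v1 v0 ⇒̇ v1 ∈̇ suc (suc a) ∧̇ v0 ∈̇ suc (suc b)))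
    ∧̇ ∀∈ a (∃̇ mapsᶠ (suc (suc g)) v1 v0)

  isOrderTypeᶠ : Fin n → Fin n → Fin n → Fin n → Formula P n
  isOrderTypeᶠ h δ g ν =
       ∀∈ δ (subsetᶠ v0 (suc δ))
    ∧̇ functionalᶠ h
    ∧̇ injectiveᶠ h
    ∧̇ ∀∈ δ (∃̇ ∃̇ (mapsᶠ (suc (suc (suc h))) v2 v1 ∧̇ mapsᶠ (suc (suc (suc g))) v1 v0 ∧̇ v0 ∈̇ suc (suc (suc ν))))
    ∧̇ (∀̇ ∀̇ (mapsᶠ (suc (suc g)) v1 v0 ⇒̇ v0 ∈̇ suc (suc ν) ⇒̇ ∃∈ (suc (suc δ)) (mapsᶠ (suc (suc (suc h))) v0 v2)))
    ∧̇ (∀̇ ∀̇ ∀̇ ∀̇ (v3 ∈̇ suc (suc (suc (suc δ))) ⇒̇ v2 ∈̇ suc (suc (suc (suc δ))) ⇒̇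
         mapsᶠ (suc (suc (suc (suc h)))) v3 v1 ⇒̇ mapsᶠ (suc (suc (suc (suc h)))) v2 v0 ⇒̇
         (v3 ∈̇ v2 ⇔̇ v1 ∈̇ v0)))

-- Order types, choice functions and cardinality

module Ordertypes {ℓ} (em : ExcludedMiddle ℓ) (𝒰 : Universe ℓ) (zfc : IsZFC 𝒰) where
  open Universe 𝒰
  open Relativized 𝒰 (𝕍 𝒰)
  open SetTheory em 𝒰 zfc
  open On 𝒰 (𝕍 𝒰)

  -- The order type `δ` of a set `B` of ordinals, with `h` the increasing enumeration of `B`, that
  -- is, the inverse of its transitive collapse.
  record OrderType (bound B : V) : Set ℓ where
    field
      δ h   : V
      le    : δ ∈ bound ⊎ δ ≡ bound
      tr    : ∀ {x z} → x ∈ δ → z ∈ x → z ∈ δ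
      dom   : ∀ {x y} → Maps h x y → x ∈ δ
      ran   : ∀ {x y} → Maps h x y → y ∈ B
      fun   : Functional h
      inj   : Injective h
      total : ∀ {x} → x ∈ δ → ∃ λ y → Maps h x y
      onto  : ∀ {y} → y ∈ B → ∃ λ x → Maps h x y
      mono  : ∀ {x y u v} → Maps h x u → Maps h y v → x ∈ y ⇔ u ∈ v

  module OrderTypeConstruction {bound B : V} (o : IsOrdinal bound) (B⊆ : ∀ {x} → x ∈ B → x ∈ bound) where

    -- Drives the recursion that enumerates `B` in increasing order; `s` stands for the values
    -- already listed.
    Least : V → V → Set ℓ
    Least s b = ¬ b ∈ s × (∀ᴰ[ c ] (c ∈ B → ¬ c ∈ s → ¬ c ∈ b))

    abstract
      powerset-of-B : ∃ λ p → ∀ x → x ∈ p ⇔ x ⊆ B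
      powerset-of-B = pow B

      next : Graph (proj₁ powerset-of-B) B Least
      next = comp _ B Least (¬̇ (v0 ∈̇ v1) ∧̇ ∀̇ (v0 ∈̇ v5 ⇒̇ ¬̇ (v0 ∈̇ v2) ⇒̇ ¬̇ (v0 ∈̇ v1))) [] λ _ _ _ → refl

    open Graph next renaming (graph to G)

    G-fun : Functional G
    G-fun m m′ with inv m | inv m′
    ... | _ , b∈ , b∉ , b-min | _ , c∈ , c∉ , c-min with ord-lin o (B⊆ b∈) (B⊆ c∈)
    ... | inj₁ p        = ⊥-elim (c-min _ _ b∈ b∉ p)
    ... | inj₂ (inj₁ e) = e
    ... | inj₂ (inj₂ p) = ⊥-elim (b-min _ _ c∈ c∉ p)
    G-ran : ∀ {s y} → Maps G s y → y ∈ B × ¬ y ∈ s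
    G-ran m with inv m
    ... | _ , y∈B , y∉s , _ = y∈B , y∉s
    abstract
      rec : Recursion bound G
      rec = RecursionTheorem.recursion bound B G o G-fun G-ran

    open Recursion rec renaming (dom to δ)
    ran : ∀ {x y} → Maps H x y → y ∈ B
    ran m with H-step m
    ... | _ , _ , g = proj₁ (G-ran g)
    minimal : ∀ {x y c} → Maps H x y → c ∈ B → (∀ {u} → u ∈ x → ¬ Maps H u c) → ¬ c ∈ y
    minimal m c∈B new with H-step m
    ... | s , hs , g with inv g
    ... | _ , _ , _ , min = min _ _ c∈B λ c∈s → case (to (hs _ _) c∈s)
      where
      case : (∃ᴰ[ u ] (u ∈ _ × Maps H u _)) → ⊥
      case (_ , _ , u∈x , m′) = new u∈x m′
    mono : ∀ {x y u v} → Maps H x u → Maps H y v → x ∈ y → u ∈ v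
    mono {x} {y} m m′ x∈y with ord-lin o (B⊆ (ran m)) (B⊆ (ran m′))
    ... | inj₁ p           = p
    ... | inj₂ (inj₁ refl) = ⊥-elim (∈-irrefl (subst (_∈ y) (H-inj m m′) x∈y))
    ... | inj₂ (inj₂ v∈u)  = ⊥-elim (minimal m (ran m′)
            (λ w∈x a → ∈-asym x∈y (subst (_∈ x) (H-inj a m′) w∈x)) v∈u)
    H-ord : ∀ {x u} → Maps H x u → x ∈ bound
    H-ord {x} m with dom-le
    ... | inj₁ p    = ord-trans o p (H-dom m)
    ... | inj₂ e    = subst (_ ∈_) e (H-dom m)
    mono⁻ : ∀ {x y u v} → Maps H x u → Maps H y v → u ∈ v → x ∈ y
    mono⁻ m m′ u∈v with ord-lin o (H-ord m) (H-ord m′)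
    ... | inj₁ p           = p
    ... | inj₂ (inj₁ refl) = ⊥-elim (∈-irrefl (subst (_∈ _) (H-fun m m′) u∈v))
    ... | inj₂ (inj₂ p)    = ⊥-elim (∈-asym u∈v (mono m′ m p))
    -- The usual `x ≤ H(x)` for an increasing map: a least `x` with `H(x) ∈ x` would give the
    -- smaller counterexample `H(x)`.
    increasing : ∀ {x y} → Maps H x y → ¬ y ∈ x
    increasing {x} {y} m y∈x with least (∃̇ (mapsᶠ v2 v1 v0 ∧̇ v0 ∈̇ v1)) (H ∷ []) δ (H-dom m) (y , _ , m , y∈x)
    ... | x , x∈δ , (y , _ , m , y∈x) , min with H-total (dom-tr x∈δ y∈x)
    ... | y′ , m′ = min y (dom-tr x∈δ y∈x) (y′ , _ , m′ , mono m′ m y∈x) y∈x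
    -- If the recursion runs through all of `bound`, then `b ≤ H(b)`, while leastness of the values
    -- forbids `b ∈ H(b)`. If it stops earlier, the least element of `B` not yet listed would be a
    -- further value.
    missed : ∀ {b} → b ∈ B → (∀ x → ¬ Maps H x b) → ⊥
    missed {b} b∈B miss with stuck
    ... | inj₁ e with H-total (subst (_ ∈_) (sym e) (B⊆ b∈B))
    ...   | y , m with ord-lin o (B⊆ (ran m)) (B⊆ b∈B)
    ...     | inj₁ p           = increasing m p
    ...     | inj₂ (inj₁ refl) = miss _ m
    ...     | inj₂ (inj₂ p)    = minimal m b∈B (λ _ → miss _) p
    missed {b} b∈B miss | inj₂ st with image-exists δ ran
    ... | s , hs with least (¬̇ (v0 ∈̇ v1)) (s ∷ []) B b∈B (λ b∈s → miss _ (proj₂ (proj₂ (proj₂ (to (hs b _) b∈s)))))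
    ... | m , m∈B , m∉s , min = st s m hs (intro s∈ m∈B (m∉s , λ c _ → min c))
      where
      s∈ : s ∈ proj₁ powerset-of-B
      s∈ = from (proj₂ powerset-of-B s) λ z _ z∈s → ran (proj₂ (proj₂ (proj₂ (to (hs z _) z∈s))))
    onto : ∀ {y} → y ∈ B → ∃ λ x → Maps H x y
    onto {y} y∈B = byContradiction λ h → missed y∈B λ x m → h (x , m)

  abstract
    orderType : ∀ {bound B} → IsOrdinal bound → (∀ {x} → x ∈ B → x ∈ bound) → OrderType bound B
    orderType o B⊆ = record
      { δ = δ ; h = H ; le = dom-le ; tr = dom-tr ; dom = H-dom ; ran = ran ; fun = H-fun ; inj = H-inj
      ; total = H-total ; onto = onto ; mono = λ m m′ → mk⇔ (mono m m′) (mono⁻ m m′) }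
      where
      open OrderTypeConstruction o B⊆
      open Recursion rec renaming (dom to δ)

    -- The axiom selects from a set of nonempty sets, so it is applied to the set `F` of fibres {y ∈
    -- b : R(x, y)}; `f` sends `x` to the element chosen from its fibre.
    choose : ∀ {R a b} → (∀ {x} → x ∈ a → ∃ λ y → y ∈ b × Maps R x y) →
             ∃ λ f → Functional f × (∀ {x y} → Maps f x y → x ∈ a × y ∈ b × Maps R x y)
                   × (∀ {x} → x ∈ a → ∃ λ y → Maps f x y)
    choose {R} {a} {b} tot with pow b
    ... | Pb , hPb with sep (∃̇ (v0 ∈̇ v2 ∧̇ ∀̇ (v0 ∈̇ v2 ⇔̇ v0 ∈̇ v4 ∧̇ mapsᶠ v5 v1 v0))) (a ∷ b ∷ R ∷ []) Pb
    ... | F , hF with proj₂ zfc F _ (λ Y _ Y∈F → nonempty Y (to (hF Y) Y∈F))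
      where
      nonempty : ∀ Y → Y ∈ Pb × (∃ᴰ[ x ] (x ∈ a × (∀ᴰ[ y ] (y ∈ Y ⇔ (y ∈ b × Maps R x y))))) → ∃ᴰ[ y ] y ∈ Y
      nonempty Y (_ , x , _ , x∈a , hY) with tot x∈a
      ... | y , y∈b , m = y , _ , from (hY y _) (y∈b , m)
    ... | c , _ , (_ , c-tot , c-fun) , c-sel = f , f-fun , f-inv , f-tot
      where
      Fibre : V → V → Set ℓ
      Fibre x Y = ∀ᴰ[ z ] (z ∈ Y ⇔ (z ∈ b × Maps R x z))
      chosen : Graph a b (λ x y → ∃ᴰ[ Y ] (Fibre x Y × Maps c Y y))
      chosen = comp a b _ (∃̇ (∀̇ (v0 ∈̇ v1 ⇔̇ v0 ∈̇ v6 ∧̇ mapsᶠ v7 v3 v0) ∧̇ mapsᶠ v7 v0 v1)) (R ∷ c ∷ []) λ _ _ _ → refl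
      open Graph chosen renaming (graph to f)
      f-fun : Functional f
      f-fun m m′ with inv m | inv m′
      ... | _ , _ , Y , _ , hY , n | _ , _ , Y′ , _ , hY′ , n′
        with ext (λ z p → from (hY′ z _) (to (hY z _) p)) (λ z p → from (hY z _) (to (hY′ z _) p))
      ... | refl = c-fun _ _ _ _ _ _ n n′
      f-inv : ∀ {x y} → Maps f x y → x ∈ a × y ∈ b × Maps R x y
      f-inv m with inv m
      ... | x∈a , y∈b , Y , _ , hY , n = x∈a , y∈b , proj₂ (to (hY _ _) (c-sel _ _ _ _ n))
      f-tot : ∀ {x} → x ∈ a → ∃ λ y → Maps f x y
      f-tot {x} x∈a with sep (mapsᶠ v2 v1 v0) (x ∷ R ∷ []) b
      ... | Y , hY with c-tot Y _ (from (hF Y) (from (hPb Y) (λ z _ z∈Y → proj₁ (to (hY z) z∈Y)) , x , _ , x∈a , λ z _ → hY z))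
      ... | y , _ , n = y , intro x∈a (proj₁ (to (hY y) (c-sel _ _ _ _ n))) (Y , _ , (λ z _ → hY z) , n)

    -- `h` may contain pairs outside `a × b`; its restriction is the bijection.
    equinumerous : ∀ {h a b} → Functional h → Injective h → (∀ {x} → x ∈ a → ∃ λ y → y ∈ b × Maps h x y) →
                   (∀ {y} → y ∈ b → ∃ λ x → x ∈ a × Maps h x y) → Equinumerous a b
    equinumerous {h} {a} {b} fun inj tot onto =
        f , _
      , ( (λ p _ p∈f → let (x , y , x∈a , _ , P) = pairs p p∈f in x , _ , y , _ , x∈a , P)
        , (λ x _ x∈a → let (y , y∈b , m) = tot x∈a in y , _ , intro x∈a y∈b m)
        , λ x _ y _ z _ m m′ → fun (inner m) (inner m′))
      , (λ x _ y _ m → proj₁ (proj₂ (inv m)))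
      , (λ x _ y _ z _ m m′ → inj (inner m) (inner m′))
      , λ y _ y∈b → let (x , x∈a , m) = onto y∈b in x , _ , intro x∈a y∈b m
      where
      clean : Graph a b (Maps h)
      clean = comp a b (Maps h) (mapsᶠ v5 v1 v0) (h ∷ []) λ _ _ _ → refl
      open Graph clean renaming (graph to f)
      inner : ∀ {x y} → Maps f x y → Maps h x y
      inner m = proj₂ (proj₂ (inv m))

    bijection-dom : ∀ {f a b x y} → IsBijection f a b → Maps f x y → x ∈ a
    bijection-dom {a = a} ((prs , _) , _) (p , _ , P , p∈f) with prs p _ p∈f
    ... | x′ , _ , y′ , _ , x′∈a , P′ = subst (_∈ a) (pair-injˡ P′ P) x′∈a

    equinumerous-refl : ∀ a → Equinumerous a a
    equinumerous-refl a = equinumerous {h = graph}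
        (λ m m′ → trans (sym (eq m)) (eq m′)) (λ m m′ → trans (eq m) (sym (eq m′)))
        (λ x∈a → _ , x∈a , intro x∈a x∈a refl) (λ x∈a → _ , x∈a , intro x∈a x∈a refl)
      where
      identity : Graph a a _≡_
      identity = comp a a _≡_ (v1 ≡̇ v0) [] λ _ _ _ → refl
      open Graph identity
      eq : ∀ {x y} → Maps graph x y → x ≡ y
      eq m = proj₂ (proj₂ (inv m))

    successor-unique : ∀ {μ μ′ κ} → IsSuccessorCardinal μ κ → IsSuccessorCardinal μ′ κ → μ ≡ μ′
    successor-unique (c@(o , _) , κ∈μ , min) (c′@(o′ , _) , κ∈μ′ , min′) with trichotomy o o′
    ... | inj₁ p        = ⊥-elim (min′ _ _ c κ∈μ p)
    ... | inj₂ (inj₁ e) = e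
    ... | inj₂ (inj₂ p) = ⊥-elim (min _ _ c′ κ∈μ′ p)

    injection-graph : ∀ {Q : V → V → Set ℓ} {a b} (Γ : Graph a b Q) →
      (∀ {x y z} → x ∈ a → Q x y → Q x z → y ≡ z) → (∀ {x y z} → x ∈ a → y ∈ a → Q x z → Q y z → x ≡ y) →
      (∀ {x} → x ∈ a → ∃ λ y → y ∈ b × Q x y) → IsInjectionᴰ (Graph.graph Γ) a b
    injection-graph Γ fun inj tot =
        (λ x _ y _ z _ m m′ → fun (proj₁ (inv m)) (proj₂ (proj₂ (inv m))) (proj₂ (proj₂ (inv m′))))
      , (λ x _ y _ z _ m m′ → inj (proj₁ (inv m)) (proj₁ (inv m′)) (proj₂ (proj₂ (inv m))) (proj₂ (proj₂ (inv m′))))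
      , (λ x _ y _ m → proj₁ (inv m) , proj₁ (proj₂ (inv m)))
      , λ x _ x∈a → let (y , y∈b , q) = tot x∈a in y , _ , intro x∈a y∈b q
      where open Graph Γ

    -- Let `ν` be the least ordinal below `μ` into which `α` injects. If it exceeded `κ`, it would
    -- be a cardinal strictly between `κ` and `μ`, since a bijection with a smaller ordinal would
    -- carry the injection there.
    injection-below-successor : ∀ {κ μ α} → IsOrdinal κ → IsSuccessorCardinal μ κ → α ∈ μ →
                                ∃ λ g → IsInjectionᴰ g α κ
    injection-below-successor {κ} {μ} {α} oκ (cμ@(oμ , _) , κ∈μ , no-between) α∈μ =
      go (least (∃̇ isInjectionᶠ v0 v2 v1) (α ∷ []) μ α∈μ (Graph.graph identity , _ , identity-inj))
      where
      identity : Graph α α _≡_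
      identity = comp α α _≡_ (v1 ≡̇ v0) [] λ _ _ _ → refl
      identity-inj : IsInjectionᴰ (Graph.graph identity) α α
      identity-inj = injection-graph identity (λ _ e e′ → trans (sym e) e′) (λ _ _ e e′ → trans e (sym e′)) (λ x∈α → _ , x∈α , refl)
      Into : V → Set ℓ
      Into ν = ∃ᴰ[ g ] IsInjectionᴰ g α ν
      go : (∃ λ ν → ν ∈ μ × Into ν × (∀ β → β ∈ μ → Into β → ¬ β ∈ ν)) → ∃ λ g → IsInjectionᴰ g α κ
      go (ν , ν∈μ , (g , _ , gf , gi , gr , gt) , min) with trichotomy (ord-elem oμ ν∈μ) oκ
      ... | inj₁ ν∈κ = g , gf , gi , (λ x _ y _ m → proj₁ (gr x _ y _ m) , ord-trans oκ ν∈κ (proj₂ (gr x _ y _ m))) , gt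
      ... | inj₂ (inj₁ refl) = g , gf , gi , gr , gt
      ... | inj₂ (inj₂ κ∈ν) = ⊥-elim (no-between ν _ card κ∈ν ν∈μ)
        where
        shrink : ∀ {β} → β ∈ ν → ¬ Equinumerous β ν
        shrink {β} β∈ν (f , _ , f-bij@((_ , _ , f-fun) , _ , f-inj , f-onto)) =
          min β (ord-trans oμ ν∈μ β∈ν)
            (graph , _ , injection-graph Γ
              (λ { _ (z , _ , m , n) (z′ , _ , m′ , n′) →
                   f-inj _ _ _ _ _ _ n (subst (Maps f _) (gf _ _ _ _ _ _ m′ m) n′) })
              (λ { _ _ (z , _ , m , n) (z′ , _ , m′ , n′) →
                   gi _ _ _ _ _ _ m (subst (Maps g _) (f-fun _ _ _ _ _ _ n′ n) m′) })
              λ {x} x∈α → let (z , _ , m) = gt x _ x∈α ; (y , _ , n) = f-onto z _ (proj₂ (gr _ _ _ _ m)) in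
                 y , bijection-dom f-bij n , z , _ , m , n) β∈ν
          where
          Γ : Graph α β (λ x y → ∃ᴰ[ z ] (Maps g x z × Maps f y z))
          Γ = comp α β _ (∃̇ (mapsᶠ v6 v2 v0 ∧̇ mapsᶠ v7 v1 v0)) (g ∷ f ∷ []) λ _ _ _ → refl
          open Graph Γ
        card : IsCardinal ν
        card = ord-elem oμ ν∈μ , equinumerous-refl ν , λ β _ → shrink

    choose-injections : ∀ {κ μ b} (Γ : Graph μ b (λ α g → IsInjectionᴰ g α κ)) →
      (∀ {α} → α ∈ μ → ∃ λ g → g ∈ b × IsInjectionᴰ g α κ) →
      ∃ λ f → Functional f × (∀ {α g} → Maps f α g → α ∈ μ × IsInjectionᴰ g α κ) × (∀ {α} → α ∈ μ → ∃ λ g → Maps f α g)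
    choose-injections Γ tot
      with choose {Graph.graph Γ} (λ {α} α∈μ →
             let (g , g∈b , gi) = tot α∈μ in g , g∈b , Graph.intro Γ α∈μ g∈b gi)
    ... | f , ff , fi , ft = f , ff , (λ m → let (_ , _ , n) = fi m ; (α∈μ , _ , gi) = Graph.inv Γ n in α∈μ , gi) , ft

    -- Choosing one injection for each `α` needs a set to choose from, so every injection is first
    -- cut down to a subset of `α × κ`, an element of one fixed power set.
    injections-below-successor : ∀ {κ μ} → IsOrdinal κ → IsSuccessorCardinal μ κ →
      ∃ λ f → Functional f × (∀ {α g} → Maps f α g → α ∈ μ × IsInjectionᴰ g α κ) × (∀ {α} → α ∈ μ → ∃ λ g → Maps f α g)
    injections-below-successor {κ} {μ} oκ sμ@((oμ , _) , _) with pair-bound μ κ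
    ... | c , hc with pow c
    ... | b , hb = choose-injections
          (comp μ b (λ α g → IsInjectionᴰ g α κ) (isInjectionᶠ v0 v1 v5) (κ ∷ []) λ _ _ _ → refl)
          λ α∈μ → bounded α∈μ (injection-below-successor oκ sμ α∈μ)
      where
      bounded : ∀ {α} → α ∈ μ → (∃ λ g → IsInjectionᴰ g α κ) → ∃ λ g → g ∈ b × IsInjectionᴰ g α κ
      bounded {α} α∈μ (g , gf , gi , gr , gt) = Graph.graph clean , from (hb _) g∈b , injection-graph clean
          (λ _ → gf _ _ _ _ _ _) (λ _ _ → gi _ _ _ _ _ _)
          λ x∈α → let (y , _ , m) = gt _ _ x∈α in y , proj₂ (gr _ _ _ _ m) , m
        where
        clean : Graph α κ (Maps g)
        clean = comp α κ (Maps g) (mapsᶠ v5 v1 v0) (g ∷ []) λ _ _ _ → refl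
        g∈b : Graph.graph clean ⊆ c
        g∈b p _ p∈ with Graph.pairs clean p p∈
        ... | x , y , x∈α , y∈κ , P = hc (ord-trans oμ α∈μ x∈α) y∈κ P

-- Absoluteness, elementary embeddings and critical points

module Embeddings {ℓ} (em : ExcludedMiddle ℓ) (𝒰 : Universe ℓ) (zfc : IsZFC 𝒰) where
  open Universe 𝒰
  open Relativized 𝒰 (𝕍 𝒰)
  open SetTheory em 𝒰 zfc
  open Ordertypes em 𝒰 zfc

  Transitive : (V → Set ℓ) → Set ℓ
  Transitive D = ∀ x y → D x → y ∈ x → D y

  -- The notions concerned are bounded or have their witnesses inside the objects they speak of, so
  -- a transitive `D` computes them correctly. The arrow ↓ passes from V to `D`, the arrow ↑ from
  -- `D` to V.
  module Absoluteness {D : V → Set ℓ} (tr : Transitive D) where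
    private module R = Relativized 𝒰 D

    upair↑ : ∀ {u x y} → D u → D x → D y → R.IsUnorderedPair u x y → IsUnorderedPair u x y
    upair↑ {u} Du Dx Dy h z _ = mk⇔ (λ z∈u → to (h z (tr _ _ Du z∈u)) z∈u) λ e → from (h z (Dz e)) e
      where
      Dz : _ ⊎ _ → D z
      Dz (inj₁ refl) = Dx
      Dz (inj₂ refl) = Dy

    pair↓ : ∀ {p x y} → D p → IsOrderedPair p x y → D x × D y × R.IsOrderedPair p x y
    pair↓ {p} {x} {y} Dp (s , _ , t , _ , hs , ht , hp) =
        tr s x Ds (from (hs x _) (inj₁ refl)) , tr t y Dt (from (ht y _) (inj₂ refl))
      , s , Ds , t , Dt , (λ z _ → hs z _) , (λ z _ → ht z _) , λ z _ → hp z _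
      where
      Ds : D s
      Ds = tr p s Dp (from (hp s _) (inj₁ refl))
      Dt : D t
      Dt = tr p t Dp (from (hp t _) (inj₂ refl))

    pair↑ : ∀ {p x y} → D p → D x → D y → R.IsOrderedPair p x y → IsOrderedPair p x y
    pair↑ Dp Dx Dy (s , Ds , t , Dt , hs , ht , hp) =
      s , _ , t , _ , upair↑ Ds Dx Dx hs , upair↑ Dt Dx Dy ht , upair↑ Dp Ds Dt hp

    maps↓ : ∀ {f x y} → D f → Maps f x y → D x × D y × R.Maps f x y
    maps↓ Df (p , _ , P , p∈f) with pair↓ (tr _ _ Df p∈f) P
    ... | Dx , Dy , P′ = Dx , Dy , p , tr _ _ Df p∈f , P′ , p∈f

    maps↑ : ∀ {f x y} → D x → D y → R.Maps f x y → Maps f x y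
    maps↑ Dx Dy (p , Dp , P , p∈f) = p , _ , pair↑ Dp Dx Dy P , p∈f

    functional↓ : ∀ {g} → Functional g → On.Functionalᴰ 𝒰 D g
    functional↓ h x Dx y Dy z Dz m n = h (maps↑ Dx Dy m) (maps↑ Dx Dz n)

    functional↑ : ∀ {g} → D g → On.Functionalᴰ 𝒰 D g → Functional g
    functional↑ Dg h m n with maps↓ Dg m | maps↓ Dg n
    ... | Dx , Dy , m′ | _ , Dz , n′ = h _ Dx _ Dy _ Dz m′ n′

    injective↓ : ∀ {g} → Injective g → On.Injectiveᴰ 𝒰 D g
    injective↓ h x Dx y Dy z Dz m n = h (maps↑ Dx Dz m) (maps↑ Dy Dz n)

    injective↑ : ∀ {g} → D g → On.Injectiveᴰ 𝒰 D g → Injective g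
    injective↑ Dg h m n with maps↓ Dg m | maps↓ Dg n
    ... | Dx , Dz , m′ | Dy , _ , n′ = h _ Dx _ Dy _ Dz m′ n′

    subset↑ : ∀ {x y} → D x → R._⊆_ x y → x ⊆ y
    subset↑ Dx h z _ z∈x = h z (tr _ _ Dx z∈x) z∈x

    ordinal↓ : ∀ {α} → IsOrdinal α → R.IsOrdinal α
    ordinal↓ (t , l) = (λ x _ x∈α z _ → t x _ x∈α z _) , λ x _ y _ → l x _ y _

    ordinal↑ : ∀ {α} → D α → R.IsOrdinal α → IsOrdinal α
    ordinal↑ Dα (t , l) = (λ x _ x∈α → subset↑ (tr _ _ Dα x∈α) (t x (tr _ _ Dα x∈α) x∈α))
                        , λ x _ y _ x∈α y∈α → l x (tr _ _ Dα x∈α) y (tr _ _ Dα y∈α) x∈α y∈α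

    injection↑ : ∀ {g a b} → D g → D a → On.IsInjectionᴰ 𝒰 D g a b → On.IsInjectionᴰ 𝒰 (𝕍 𝒰) g a b
    injection↑ Dg Da (gf , gi , gr , gt) =
        (λ x _ y _ z _ → functional↑ Dg gf)
      , (λ x _ y _ z _ → injective↑ Dg gi)
      , (λ x _ y _ m → let (Dx , Dy , m′) = maps↓ Dg m in gr x Dx y Dy m′)
      , λ x _ x∈a → let (y , Dy , m) = gt x (tr _ _ Da x∈a) x∈a in y , _ , maps↑ (tr _ _ Da x∈a) Dy m

    orderType↑ : ∀ {h δ g ν} → D h → D δ → D g → On.IsOrderTypeᴰ 𝒰 D h δ g ν → On.IsOrderTypeᴰ 𝒰 (𝕍 𝒰) h δ g ν
    orderType↑ {δ = δ} Dh Dδ Dg (tδ , hf , hi , ha , hb , hm) =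
        (λ x _ x∈δ → subset↑ (tr _ _ Dδ x∈δ) (tδ x (tr _ _ Dδ x∈δ) x∈δ))
      , (λ x _ y _ z _ → functional↑ Dh hf)
      , (λ x _ y _ z _ → injective↑ Dh hi)
      , (λ x _ x∈δ → let (y , Dy , z , Dz , m , n , z∈ν) = ha x (tr _ _ Dδ x∈δ) x∈δ in
           y , _ , z , _ , maps↑ (tr _ _ Dδ x∈δ) Dy m , maps↑ Dy Dz n , z∈ν)
      , (λ y _ z _ n z∈ν → let (Dy , Dz , n′) = maps↓ Dg n ; (x , Dx , x∈δ , m) = hb y Dy z Dz n′ z∈ν in
           x , _ , x∈δ , maps↑ Dx Dy m)
      , λ x _ y _ u _ v _ x∈δ y∈δ m n → let (Dx , Du , m′) = maps↓ Dh m ; (Dy , Dv , n′) = maps↓ Dh n in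
           hm x Dx y Dy u Du v Dv x∈δ y∈δ m′ n′

  module Embedding {D E : V → Set ℓ} {f : V → V} (trD : Transitive D) (trE : Transitive E)
                   (emb : IsElementaryEmbedding 𝒰 D E f) where
    open IsElementaryEmbedding emb
    private
      module D = Absoluteness trD
      module E = Absoluteness trE
      Sᴰ Sᴱ : ∀ {n} → Formula (NoSymbols 𝒰) n → Vec V n → Set ℓ
      Sᴰ = Relativized.Sat 𝒰 D (noSymbols 𝒰)
      Sᴱ = Relativized.Sat 𝒰 E (noSymbols 𝒰)

    push : ∀ {n} (φ : Formula (NoSymbols 𝒰) n) (ρ : Vec V n) → All D ρ → Sᴰ φ ρ → Sᴱ φ (map f ρ)
    push φ ρ h = to (elementary φ ρ h)

    pull : ∀ {n} (φ : Formula (NoSymbols 𝒰) n) (ρ : Vec V n) → All D ρ → Sᴱ φ (map f ρ) → Sᴰ φ ρ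
    pull φ ρ h = from (elementary φ ρ h)

    image : ∀ {x} → D x → E (f x)
    image = maps _

    ∈→ : ∀ {x y} → D x → D y → x ∈ y → f x ∈ f y
    ∈→ Dx Dy = push (v0 ∈̇ v1) (_ ∷ _ ∷ []) (Dx ∷ Dy ∷ [])

    ∈← : ∀ {x y} → D x → D y → f x ∈ f y → x ∈ y
    ∈← Dx Dy = pull (v0 ∈̇ v1) (_ ∷ _ ∷ []) (Dx ∷ Dy ∷ [])

    subset→ : ∀ {x y} → D x → D y → x ⊆ y → f x ⊆ f y
    subset→ Dx Dy h = E.subset↑ (image Dx) (push (subsetᶠ v0 v1) (_ ∷ _ ∷ []) (Dx ∷ Dy ∷ []) λ z _ → h z _)

    pair→ : ∀ {p x y} → D p → IsOrderedPair p x y → IsOrderedPair (f p) (f x) (f y)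
    pair→ Dp P with D.pair↓ Dp P
    ... | Dx , Dy , P′ = E.pair↑ (image Dp) (image Dx) (image Dy)
                           (push (pairᶠ v0 v1 v2) (_ ∷ _ ∷ _ ∷ []) (Dp ∷ Dx ∷ Dy ∷ []) P′)

    maps→ : ∀ {g x y} → D g → Maps g x y → Maps (f g) (f x) (f y)
    maps→ Dg m with D.maps↓ Dg m
    ... | Dx , Dy , m′ = E.maps↑ (image Dx) (image Dy)
                           (push (mapsᶠ v0 v1 v2) (_ ∷ _ ∷ _ ∷ []) (Dg ∷ Dx ∷ Dy ∷ []) m′)

    functional→ : ∀ {g} → D g → Functional g → Functional (f g)
    functional→ {g} Dg h = E.functional↑ (image Dg) (push (functionalᶠ v0) (g ∷ []) (Dg ∷ []) (D.functional↓ h))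

    injective→ : ∀ {g} → D g → Injective g → Injective (f g)
    injective→ {g} Dg h = E.injective↑ (image Dg) (push (injectiveᶠ v0) (g ∷ []) (Dg ∷ []) (D.injective↓ h))

    ordinal→ : ∀ {α} → D α → IsOrdinal α → IsOrdinal (f α)
    ordinal→ {α} Dα o = E.ordinal↑ (image Dα) (push
      (ordinalᶠ v0) (α ∷ []) (Dα ∷ []) (D.ordinal↓ o))

    total→ : ∀ {g a} → D g → D a → (∀ {x} → x ∈ a → ∃ λ y → Maps g x y) →
             ∀ {x} → x ∈ f a → ∃ λ y → Maps (f g) x y
    total→ {g} {a} Dg Da h {x} x∈fa
      with push (∀∈ v1 (∃̇ mapsᶠ v2 v1 v0)) (g ∷ a ∷ []) (Dg ∷ Da ∷ [])
             (λ x _ x∈a → let (y , m) = h x∈a ; (_ , Dy , m′) = D.maps↓ Dg m in y , Dy , m′)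
             x (trE _ _ (image Da) x∈fa) x∈fa
    ... | y , Ey , m = y , E.maps↑ (trE _ _ (image Da) x∈fa) Ey m

    total-in→ : ∀ {g a b} → D g → D a → D b → (∀ {x} → x ∈ a → ∃ λ y → y ∈ b × Maps g x y) →
                ∀ {x} → x ∈ f a → ∃ λ y → y ∈ f b × Maps (f g) x y
    total-in→ {g} {a} {b} Dg Da Db h {x} x∈fa
      with push (∀∈ v1 (∃∈ v3 (mapsᶠ v2 v1 v0))) (g ∷ a ∷ b ∷ []) (Dg ∷ Da ∷ Db ∷ [])
             (λ x _ x∈a → let (y , y∈b , m) = h x∈a ; (_ , Dy , m′) = D.maps↓ Dg m in y , Dy , y∈b , m′)
             x (trE _ _ (image Da) x∈fa) x∈fa
    ... | y , Ey , y∈fb , m = y , y∈fb , E.maps↑ (trE _ _ (image Da) x∈fa) Ey m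

    dom→ : ∀ {g a} → D g → D a → (∀ {x y} → Maps g x y → x ∈ a) → ∀ {x y} → Maps (f g) x y → x ∈ f a
    dom→ {g} {a} Dg Da h {x} {y} m =
      let (Ex , Ey , m′) = E.maps↓ (image Dg) m in
      push (∀̇ ∀̇ (mapsᶠ v2 v1 v0 ⇒̇ v1 ∈̇ v3)) (g ∷ a ∷ []) (Dg ∷ Da ∷ [])
           (λ x Dx y Dy m → h (D.maps↑ Dx Dy m)) x Ex y Ey m′

    onto→ : ∀ {g a b} → D g → D a → D b → (∀ {y} → y ∈ b → ∃ λ x → x ∈ a × Maps g x y) →
            ∀ {y} → y ∈ f b → ∃ λ x → x ∈ f a × Maps (f g) x y
    onto→ {g} {a} {b} Dg Da Db h {y} y∈fb
      with push (∀∈ v2 (∃∈ v2 (mapsᶠ v2 v0 v1))) (g ∷ a ∷ b ∷ []) (Dg ∷ Da ∷ Db ∷ [])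
             (λ y _ y∈b → let (x , x∈a , m) = h y∈b ; (Dx , _ , m′) = D.maps↓ Dg m in x , Dx , x∈a , m′)
             y (trE _ _ (image Db) y∈fb) y∈fb
    ... | x , Ex , x∈fa , m = x , x∈fa , E.maps↑ Ex (trE _ _ (image Db) y∈fb) m

    -- The function, its value and the bound are images under `f`, so the existence of an argument
    -- reflects to `D`.
    preimage : ∀ {g a w x} → D g → D a → D w → x ∈ f a → Maps (f g) x (f w) → ∃ λ x′ → x′ ∈ a × Maps g x′ w
    preimage {g} {a} {w} {x} Dg Da Dw x∈fa m
      with pull (∃∈ v1 (mapsᶠ v1 v0 v3)) (g ∷ a ∷ w ∷ []) (Dg ∷ Da ∷ Dw ∷ [])
             (let (Ex , _ , m′) = E.maps↓ (image Dg) m in x , Ex , x∈fa , m′)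
    ... | x′ , Dx′ , x′∈a , m′ = x′ , x′∈a , D.maps↑ Dx′ Dw m′

    preimage-value : ∀ {g a x y} → D g → D a → D x → y ∈ f a → Maps (f g) (f x) y → ∃ λ y′ → y′ ∈ a × Maps g x y′
    preimage-value {g} {a} {x} {y} Dg Da Dx y∈fa m
      with pull (∃∈ v1 (mapsᶠ v1 v3 v0)) (g ∷ a ∷ x ∷ []) (Dg ∷ Da ∷ Dx ∷ [])
             (let (_ , Ey , m′) = E.maps↓ (image Dg) m in y , Ey , y∈fa , m′)
    ... | y′ , Dy′ , y′∈a , m′ = y′ , y′∈a , D.maps↑ Dx Dy′ m′

    module _ {δ : V} (Dδ : D δ) (crit : IsCriticalPoint 𝒰 f δ) where

      -- `f` fixes the elements of `δ`, so `δ` is an initial segment of the ordinal `f δ`, and the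
      -- two differ.
      critical-below : δ ∈ f δ
      critical-below with transitive-subset (ordinal→ Dδ (proj₁ crit)) (ord-trans (proj₁ crit))
                            (λ {α} α∈δ → subst (_∈ f δ) (proj₁ (proj₂ crit) α α∈δ) (∈→ (trD _ _ Dδ α∈δ) Dδ α∈δ))
      ... | inj₁ p = p
      ... | inj₂ e = ⊥-elim (proj₂ (proj₂ crit) (sym e))

      -- If `f x = δ ∈ f δ`, then `x ∈ δ` is fixed, and `δ = x ∈ δ`.
      critical∉range : ∀ {x} → D x → f x ≢ δ
      critical∉range {x} Dx e = ∈-irrefl (subst (_∈ δ) x≡δ x∈δ)
        where
        x∈δ : x ∈ δ
        x∈δ = ∈← Dx Dδ (subst (_∈ f δ) (sym e) critical-below)
        x≡δ : x ≡ δ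
        x≡δ = trans (sym (proj₁ (proj₂ crit) x x∈δ)) e

  module Critical {E : V → Set ℓ} {j : V → V} {κ : V} (trE : Transitive E)
                  (emb : IsElementaryEmbedding 𝒰 (𝕍 𝒰) E j) (crit : IsCriticalPoint 𝒰 j κ) where
    open Embedding {D = 𝕍 𝒰} _ trE emb public

    κ-ordinal : IsOrdinal κ
    κ-ordinal = proj₁ crit

    fixed : ∀ {x} → x ∈ κ → j x ≡ x
    fixed = proj₁ (proj₂ crit) _

    κ∈jκ : κ ∈ j κ
    κ∈jκ = critical-below _ crit

    κ∉range : ∀ {x} → j x ≢ κ
    κ∉range = critical∉range _ crit _

    -- Since `j F ⊆ j β = β`, both `F` and `j F` consist of ordinals fixed by `j`, and elementarity
    -- compares their elements.
    fixed-subset : ∀ {β F} → β ∈ κ → F ⊆ β → j F ≡ F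
    fixed-subset {β} {F} β∈κ F⊆β = ext
        (λ z z∈jF → let z∈β = subst (z ∈_) (fixed β∈κ) (subset→ _ _ F⊆β z _ z∈jF) in
           ∈← _ _ (subst (_∈ j F) (sym (fixed (ord-trans κ-ordinal β∈κ z∈β))) z∈jF))
        λ z z∈F → subst (_∈ j F) (fixed (ord-trans κ-ordinal β∈κ (F⊆β z _ z∈F))) (∈→ _ _ z∈F)

    -- If `j(c)(κ) = j(w)`, elementarity yields `x < κ` with `c(x) = w`; injectivity of `j(c)` then
    -- gives `j(x) = κ`, which is not in the range of `j`.
    value-at-κ : ∀ {c y w} → Injective c → Maps (j c) κ y → y ≢ j w
    value-at-κ c-inj m refl with preimage {a = κ} _ _ _ κ∈jκ m
    ... | x , x∈κ , n = κ∉range (injective→ _ c-inj (maps→ _ n) m)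

    -- The value of `j(c)` at `κ` would be an element of `j(δ) = δ`, hence fixed by `j`. This does
    -- the work of cardinality arguments at `κ`.
    no-injection : ∀ {c δ} → Injective c → δ ∈ κ → (∀ {x} → x ∈ κ → ∃ λ y → y ∈ δ × Maps c x y) → ⊥
    no-injection {c} {δ} c-inj δ∈κ tot with total-in→ _ _ _ tot κ∈jκ
    ... | y , y∈jδ , m = value-at-κ c-inj m (sym (fixed (ord-trans κ-ordinal δ∈κ (subst (y ∈_) (fixed δ∈κ) y∈jδ))))

-- Enumeration of the bounded codes along `κ`

module Enumerating {ℓ} (em : ExcludedMiddle ℓ) (𝒰 : Universe ℓ) (zfc : IsZFC 𝒰) where
  open Universe 𝒰
  open Relativized 𝒰 (𝕍 𝒰)
  open SetTheory em 𝒰 zfc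
  open Ordertypes em 𝒰 zfc
  open Embeddings em 𝒰 zfc
  open On 𝒰 (𝕍 𝒰)

  module Codes {M : V → Set ℓ} {j : V → V} {κ : V} (trM : Transitive M)
               (emb : IsElementaryEmbedding 𝒰 (𝕍 𝒰) M j) (crit : IsCriticalPoint 𝒰 j κ) where
    open Critical trM emb crit
    private
      module M = Relativized 𝒰 M
      module AM = Absoluteness trM

    M-below-j : ∀ {x a} → x ∈ j a → M x
    M-below-j x∈ja = trM _ _ (image _) x∈ja

    abstract
      -- The set `B` of those `y < α` with `g(y) < ν` injects into `ν`, so an order type of at least
      -- `κ` would inject `κ` into `ν`.
      orderType-below : ∀ {α g ν} → IsOrdinal α → IsInjectionᴰ g α κ → ν ∈ κ →
                        ∃ λ δ → δ ∈ κ × ∃ λ h → IsOrderTypeᴰ h δ g ν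
      orderType-below {α} {g} {ν} oα (gf , gi , gr , gt) ν∈κ with sep (∃∈ v1 (mapsᶠ v3 v1 v0)) (ν ∷ g ∷ []) α
      ... | B , hB = δ , δ∈κ , h , (λ x _ x∈δ z _ z∈x → tr x∈δ z∈x)
          , (λ x _ y _ z _ → fun) , (λ x _ y _ z _ → inj)
          , (λ x _ x∈δ → let (y , m) = total x∈δ ; (_ , z , _ , z∈ν , n) = to (hB y) (ran m) in y , _ , z , _ , m , n , z∈ν)
          , (λ y _ z _ n z∈ν → let (x , m) = onto (from (hB y) (proj₁ (gr _ _ _ _ n) , z , _ , z∈ν , n)) in x , _ , dom m , m)
          , λ x _ y _ u _ v _ _ _ → mono
        where
        open OrderType (orderType {α} {B} oα (λ x∈B → proj₁ (to (hB _) x∈B)))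
        δ-ord : IsOrdinal δ
        δ-ord with le
        ... | inj₁ p = ord-elem oα p
        ... | inj₂ e = subst IsOrdinal (sym e) oα
        Γ : Graph κ ν (λ x z → ∃ᴰ[ y ] (Maps h x y × Maps g y z))
        Γ = comp κ ν _ (∃̇ (mapsᶠ v6 v2 v0 ∧̇ mapsᶠ v7 v0 v1)) (h ∷ g ∷ []) λ _ _ _ → refl
        κ⊈δ : (∀ {x} → x ∈ κ → x ∈ δ) → ⊥
        κ⊈δ κ⊆δ = no-injection {Graph.graph Γ}
          (λ m m′ → let (_ , _ , y , _ , a , b) = Graph.inv Γ m ; (_ , _ , y′ , _ , a′ , b′) = Graph.inv Γ m′ in
             inj a (subst (Maps h _) (gi _ _ _ _ _ _ b′ b) a′))
          ν∈κ λ x∈κ → let (y , m) = total (κ⊆δ x∈κ) ; (_ , z , _ , z∈ν , n) = to (hB y) (ran m) in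
             z , z∈ν , Graph.intro Γ x∈κ z∈ν (y , _ , m , n)
        δ∈κ : δ ∈ κ
        δ∈κ with trichotomy δ-ord κ-ordinal
        ... | inj₁ p        = p
        ... | inj₂ (inj₁ e) = ⊥-elim (κ⊈δ (subst (_ ∈_) (sym e)))
        ... | inj₂ (inj₂ p) = ⊥-elim (κ⊈δ (ord-trans δ-ord p))

      -- Regularity of `κ`, by reflection: in `M` the values of `j(b)` on `j(δ) = δ` that lie below
      -- `j(κ)` all lie below `κ`, so a bound below `j(κ)` exists there. It is kept above `ν` so
      -- that it also bounds a code with first entry `ν`.
      functions-bounded : ∀ {ν δ b} → ν ∈ κ → δ ∈ κ → Functional b →
        ∃ λ β → β ∈ κ × ν ∈ β × (∀ {x y} → y ∈ δ → x ∈ κ → Maps b y x → x ∈ β)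
      functions-bounded {ν} {δ} {b} ν∈κ δ∈κ b-fun =
        let (β , _ , β∈κ , ν∈β , h) = pull (∃∈ v3 (v1 ∈̇ v0 ∧̇ ∀∈ v2 (∀∈ v5 (mapsᶠ v5 v1 v0 ⇒̇ v0 ∈̇ v2))))
              (ν ∷ δ ∷ b ∷ κ ∷ []) (all𝕍 _)
              (κ , M-below-j κ∈jκ , κ∈jκ , subst (_∈ κ) (sym (fixed ν∈κ)) ν∈κ , bound)
        in β , β∈κ , ν∈β , λ y∈δ x∈κ m → h _ _ y∈δ _ _ x∈κ m
        where
        inside : ∀ {y x} → y ∈ δ → x ∈ j κ → Maps (j b) y x → x ∈ κ
        inside {y} {x} y∈δ x∈jκ m =
          let jy≡y = fixed (ord-trans κ-ordinal δ∈κ y∈δ)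
              m′ = subst (λ t → Maps (j b) t x) (sym jy≡y) m
              (z , z∈κ , n) = preimage-value _ _ _ x∈jκ m′
          in subst (_∈ κ) (functional→ _ b-fun (subst (Maps (j b) (j y)) (fixed z∈κ) (maps→ _ n)) m′) z∈κ
        bound : M.∀ᴰ λ y → y ∈ j δ → M.∀ᴰ λ x → x ∈ j κ → M.Maps (j b) y x → x ∈ κ
        bound y My y∈jδ x Mx x∈jκ m = inside (subst (y ∈_) (fixed δ∈κ) y∈jδ) x∈jκ (AM.maps↑ My Mx m)

    -- Codes are graded by the bound `β`, which plays the part of a rank; a code bounded below `κ`
    -- is fixed by `j`.
    Code : V → V → Set ℓ
    Code w β = ∃ᴰ[ ν ] ∃ᴰ[ F ] (IsOrderedPair w ν F × ν ∈ β × F ⊆ β)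

    codeᶠ : ∀ {n} {P : ℕ → Set ℓ} → Fin n → Fin n → Formula P n
    codeᶠ w β = ∃̇ ∃̇ (pairᶠ (suc (suc w)) v1 v0 ∧̇ v1 ∈̇ suc (suc β) ∧̇ subsetᶠ v0 (suc (suc β)))

    code-mono : ∀ {w β γ} → (∀ {x} → x ∈ β → x ∈ γ) → Code w β → Code w γ
    code-mono β⊆γ (ν , _ , F , _ , P , ν∈β , F⊆β) = ν , _ , F , _ , P , β⊆γ ν∈β , λ z _ z∈F → β⊆γ (F⊆β z _ z∈F)

    code-fixed : ∀ {w β} → β ∈ κ → Code w β → j w ≡ w
    code-fixed β∈κ (ν , _ , F , _ , P , ν∈β , F⊆β) = pair-unique (pair→ _ P)
      (subst₂ (IsOrderedPair _) (sym (fixed (ord-trans κ-ordinal β∈κ ν∈β))) (sym (fixed-subset β∈κ F⊆β)) P)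

    abstract
      codes : ∃ λ W → ∀ w → w ∈ W ⇔ (∃ᴰ[ β ] (β ∈ κ × Code w β))
      codes with pow κ
      ... | Pκ , hPκ with pair-bound κ Pκ
      ... | c , hc with sep (∃∈ v1 (codeᶠ v1 v0)) (κ ∷ []) c
      ... | W , hW = W , λ w → mk⇔ (λ w∈W → proj₂ (to (hW w) w∈W)) λ { q@(β , _ , β∈κ , ν , _ , F , _ , P , ν∈β , F⊆β) →
              from (hW w) (hc (ord-trans κ-ordinal β∈κ ν∈β) (from (hPκ F) λ z _ z∈F → ord-trans κ-ordinal β∈κ (F⊆β z _ z∈F)) P , q) }

    W : V
    W = proj₁ codes

    W-spec : ∀ w → w ∈ W ⇔ (∃ᴰ[ β ] (β ∈ κ × Code w β))
    W-spec = proj₂ codes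

    -- Among the codes not yet listed, `w` has the least possible bound: every bound of a competitor
    -- `v` also bounds `w`. Many codes can qualify, so `selector` chooses one.
    Next : V → V → Set ℓ
    Next s w = ¬ w ∈ s × (∀ᴰ[ β ] (β ∈ κ → ∀ᴰ[ v ] (v ∈ W → ¬ v ∈ s → Code v β → Code w β)))

    abstract
      incomplete : ∃ λ a → ∀ s → s ∈ a ⇔ (s ⊆ W × (∃ᴰ[ w ] (w ∈ W × ¬ w ∈ s)))
      incomplete with pow W
      ... | PW , hPW with sep (∃∈ v1 (¬̇ (v0 ∈̇ v1))) (W ∷ []) PW
      ... | a , ha = a , λ s → mk⇔ (λ s∈a → let (s∈PW , q) = to (ha s) s∈a in to (hPW s) s∈PW , q)
                                   λ { (s⊆W , q) → from (ha s) (from (hPW s) s⊆W , q) }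

      next : Graph (proj₁ incomplete) W Next
      next = comp _ W Next (¬̇ (v0 ∈̇ v1) ∧̇ ∀∈ v5 (∀∈ v5 (¬̇ (v0 ∈̇ v3) ⇒̇ codeᶠ v0 v1 ⇒̇ codeᶠ v2 v1))) (κ ∷ []) λ _ _ _ → refl

      next-exists : ∀ {s} → s ∈ proj₁ incomplete → ∃ λ w → w ∈ W × Next s w
      next-exists {s} s∈a with to (proj₂ incomplete s) s∈a
      ... | _ , w , _ , w∈W , w∉s with to (W-spec w) w∈W
      ... | β , _ , β∈κ , cw
        with least (∃∈ v1 (¬̇ (v0 ∈̇ v3) ∧̇ codeᶠ v0 v1)) (W ∷ s ∷ []) κ β∈κ (w , _ , w∈W , w∉s , cw)
      ... | m , m∈κ , (w′ , _ , w′∈W , w′∉s , cw′) , min = w′ , w′∈W , w′∉s , minimal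
        where
        minimal : ∀ᴰ[ β ] (β ∈ κ → ∀ᴰ[ v ] (v ∈ W → ¬ v ∈ s → Code v β → Code w′ β))
        minimal β _ β∈κ v _ v∈W v∉s cv with ord-lin κ-ordinal m∈κ β∈κ
        ... | inj₁ m∈β         = code-mono (λ x∈m → ord-trans (ord-elem κ-ordinal β∈κ) m∈β x∈m) cw′
        ... | inj₂ (inj₁ refl) = cw′
        ... | inj₂ (inj₂ β∈m)  = ⊥-elim (min β β∈κ (v , _ , v∈W , v∉s , cv) β∈m)

      selector : ∃ λ G → Functional G × (∀ {s w} → Maps G s w → s ∈ proj₁ incomplete × w ∈ W × Maps (Graph.graph next) s w)
                        × (∀ {s} → s ∈ proj₁ incomplete → ∃ λ w → Maps G s w)
      selector = choose {Graph.graph next} λ s∈a → let (w , w∈W , n) = next-exists s∈a in w , w∈W , Graph.intro next s∈a w∈W n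

    G : V
    G = proj₁ selector

    G-spec : ∀ {s w} → Maps G s w → w ∈ W × Next s w
    G-spec m = let (_ , w∈W , n) = proj₁ (proj₂ (proj₂ selector)) m in w∈W , proj₂ (proj₂ (Graph.inv next n))

    abstract
      enumeration : Recursion κ G
      enumeration = RecursionTheorem.recursion κ W G κ-ordinal (proj₁ (proj₂ selector))
                      λ m → let (w∈W , w∉s , _) = G-spec m in w∈W , w∉s

    open Recursion enumeration public renaming (dom to θ; dom-le to θ-le)

    H-ran : ∀ {x y} → Maps H x y → y ∈ W
    H-ran m = let (_ , _ , g) = H-step m in proj₁ (G-spec g)

    abstract
      -- A code that is never listed competes at every stage, so each listed code obeys its bounds.
      missed-bounds : ∀ {w β} → w ∈ W → (∀ x → ¬ Maps H x w) → β ∈ κ → Code w β → ∀ {x y} → Maps H x y → Code y β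
      missed-bounds {w} {β} w∈W miss β∈κ cw {x} {y} m =
        let (s , hs , g) = H-step m
            (_ , _ , min)  = G-spec g
        in min β _ β∈κ w _ w∈W (λ w∈s → let (u , _ , _ , n) = to (hs w _) w∈s in miss u n) cw

      code↑ : ∀ {w β} → M w → M β → M.∃ᴰ (λ ν → M.∃ᴰ λ F → M.IsOrderedPair w ν F × ν ∈ β × M._⊆_ F β) → Code w β
      code↑ Mw Mβ (ν , Mν , F , MF , P , ν∈β , F⊆β) = ν , _ , F , _ , AM.pair↑ Mw Mν MF P , ν∈β , AM.subset↑ MF F⊆β

      -- By elementarity j(H)(κ) would have rank below β too, hence be fixed by j.
      bounded-enumeration : (∀ {x} → x ∈ κ → ∃ λ y → Maps H x y) →
                            (∃ λ β → β ∈ κ × (∀ {x y} → Maps H x y → Code y β)) → ⊥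
      bounded-enumeration tot (β , β∈κ , bd) =
        let (y , m)        = total→ {H} {κ} _ _ tot κ∈jκ
            (Mκ , My , m′) = AM.maps↓ (image _) m
            c = push (∀̇ ∀̇ (mapsᶠ v2 v1 v0 ⇒̇ codeᶠ v0 v3)) (H ∷ β ∷ []) (all𝕍 _) (λ x _ y _ n → bd n) κ Mκ y My m′
        in value-at-κ H-inj m (sym (code-fixed β∈κ (subst (Code y) (fixed β∈κ) (code↑ My (image _) c))))

      -- If the recursion goes on up to `κ`, a missing code would bound the whole enumeration,
      -- against `bounded-enumeration`. If it stops earlier, `G` still supplies a further value as
      -- long as a code is missing.
      not-missed : ∀ {w} → w ∈ W → (∀ x → ¬ Maps H x w) → ⊥
      not-missed {w} w∈W miss = [ full , unfinished ]′ stuck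
        where
        full : θ ≡ κ → ⊥
        full θ≡κ = bounded-enumeration
          (λ x∈κ → H-total (subst (_ ∈_) (sym θ≡κ) x∈κ))
          (let (β , _ , β∈κ , cw) = to (W-spec w) w∈W in β , β∈κ , missed-bounds w∈W miss β∈κ cw)
        unfinished : (∀ s y → IsImage s H θ → ¬ Maps G s y) → ⊥
        unfinished st =
          let (s , hs) = image-exists θ H-ran
              (y , g)  = proj₂ (proj₂ (proj₂ selector)) (from (proj₂ incomplete s)
                          ( (λ z _ z∈s → let (_ , _ , _ , m) = to (hs z _) z∈s in H-ran m)
                          , w , _ , w∈W , λ w∈s → let (u , _ , _ , m) = to (hs w _) w∈s in miss u m))
          in st s y hs g

      H-onto : ∀ {w} → w ∈ W → ∃ λ x → x ∈ θ × Maps H x w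
      H-onto w∈W = byContradiction λ h → not-missed w∈W λ x m → h (x , H-dom m , m)

    abstract
      -- `A` is covered by a function on `δ < κ`, so `A ∩ κ` is bounded by `functions-bounded` and
      -- forms a code with `ν`.
      code-exists : ∀ {ν δ b A} → ν ∈ κ → δ ∈ κ → Functional b → (∀ {x} → x ∈ A → ∃ λ y → y ∈ δ × Maps b y x) →
                    ∃ λ w → w ∈ W × ∃ λ F → IsOrderedPair w ν F × (∀ x → x ∈ F ⇔ (x ∈ A × x ∈ κ))
      code-exists {ν} {δ} {b} {A} ν∈κ δ∈κ b-fun b-onto =
        let (β , β∈κ , ν∈β , bd) = functions-bounded ν∈κ δ∈κ b-fun
            (F , hF) = sep (v0 ∈̇ v1) (κ ∷ []) A
            (w , P)  = pair-exists ν F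
        in w , from (W-spec w) (β , _ , β∈κ , ν , _ , F , _ , P , ν∈β , λ z _ z∈F →
                 let (z∈A , z∈κ) = to (hF z) z∈F ; (y , y∈δ , m) = b-onto z∈A in bd y∈δ z∈κ m)
             , F , P , hF

      -- `code-exists` carried to `M` by `j`. Its variables are quantified inside the formula so
      -- that elements of `M` outside the range of `j` may be inserted.
      code-in-M : ∀ {ν δ b A} → ν ∈ j κ → δ ∈ j κ → M A → M b → Functional b →
                  (∀ {x} → x ∈ A → ∃ λ y → y ∈ δ × Maps b y x) →
                  ∃ λ w → w ∈ j W × ∃ λ F → M F × M.IsOrderedPair w ν F × (∀ x → x ∈ F ⇔ (x ∈ A × x ∈ j κ))
      code-in-M {ν} {δ} {b} {A} ν∈jκ δ∈jκ MA Mb b-fun b-onto =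
        let (w , Mw , w∈jW , F , MF , P , hF) = push
               (∀∈ v0 (∀∈ v1 (∀̇ ∀̇ (functionalᶠ v1 ⇒̇ ∀∈ v0 (∃∈ v3 (mapsᶠ v3 v0 v1)) ⇒̇
                    ∃∈ v5 (∃̇ (pairᶠ v1 v5 v0 ∧̇ ∀̇ (v0 ∈̇ v1 ⇔̇ v0 ∈̇ v3 ∧̇ v0 ∈̇ v7)))))))
               (κ ∷ W ∷ []) (all𝕍 _)
               (λ ν _ ν∈κ δ _ δ∈κ b _ A _ bf bo →
                  let (w , w∈W , F , P , hF) = code-exists {ν} {δ} {b} {A} ν∈κ δ∈κ (bf _ _ _ _ _ _)
                                                 (λ x∈A → let (y , _ , y∈δ , m) = bo _ _ x∈A in y , y∈δ , m)
                  in w , _ , w∈W , F , _ , P , λ x _ → hF x)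
               ν (M-below-j ν∈jκ) ν∈jκ δ (M-below-j δ∈jκ) δ∈jκ b Mb A MA (AM.functional↓ b-fun)
               (λ x _ x∈A → let (y , y∈δ , m) = b-onto x∈A ; (My , _ , m′) = AM.maps↓ Mb m in y , My , y∈δ , m′)
        in w , w∈jW , F , MF , P , λ x → mk⇔ (λ x∈F → to (hF x (trM _ _ MF x∈F)) x∈F) λ q → from (hF x (trM _ _ MA (proj₁ q))) q

      code-not-in-range : ∀ {ν w F} → M ν → M w → M F → (∀ x → j x ≢ ν) → M.IsOrderedPair w ν F → ∀ x → j x ≢ w
      code-not-in-range {ν} {w} {F} Mν Mw MF ν∉j P x refl =
        let (ν′ , _ , F′ , _ , Q) = pull (∃̇ ∃̇ pairᶠ v2 v1 v0) (x ∷ []) (all𝕍 _) (ν , Mν , F , MF , P)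
        in ν∉j ν′ (pair-injˡ (pair→ _ Q) (AM.pair↑ Mw Mν MF P))

      -- An index below `κ` is fixed, so the value there would be `j` of a value of `H`.
      index∉κ : ∀ {η w} → (∀ x → j x ≢ w) → η ∈ j θ → Maps (j H) η w → ¬ η ∈ κ
      index∉κ {η} {w} w∉j η∈jθ m η∈κ =
        let (y , n) = H-total (∈← _ _ (subst (_∈ j θ) (sym (fixed η∈κ)) η∈jθ))
        in w∉j y (functional→ _ H-fun (subst (λ t → Maps (j H) t (j y)) (fixed η∈κ) (maps→ _ n)) m)

      -- If `θ < κ`, then `j(θ) = θ` leaves no index outside `κ`; hence `θ = κ`.
      index∈jκ : ∀ {η} → η ∈ j θ → ¬ η ∈ κ → θ ∈ κ ⊎ θ ≡ κ → η ∈ j κ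
      index∈jκ η∈jθ η∉κ (inj₂ e) = subst (λ t → _ ∈ j t) e η∈jθ
      index∈jκ η∈jθ η∉κ (inj₁ p) = ⊥-elim (η∉κ (ord-trans κ-ordinal p (subst (_ ∈_) (fixed p) η∈jθ)))

      -- The ordinal `η` generates the ultrafilter: it is an index that `j(H)` gives to the pair of
      -- `ν` and `A ∩ j(κ)`. It is not below `κ` because `ν` is not in the range of `j`.
      seed : ∀ {ν δ b A} → ν ∈ j κ → (∀ x → j x ≢ ν) → δ ∈ j κ → M A → M b → Functional b →
             (∀ {x} → x ∈ A → ∃ λ y → y ∈ δ × Maps b y x) →
             ∃ λ η → η ∈ j κ × ¬ η ∈ κ × ∃ λ w → Maps (j H) η w × ∃ λ F → M F × IsOrderedPair w ν F ×
               (∀ x → x ∈ F ⇔ (x ∈ A × x ∈ j κ))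
      seed ν∈jκ ν∉j δ∈jκ MA Mb b-fun b-onto =
        let (w , w∈jW , F , MF , P , hF) = code-in-M ν∈jκ δ∈jκ MA Mb b-fun b-onto
            (η , η∈jθ , m) = onto→ {H} {θ} {W} _ _ _ H-onto w∈jW
            Mν  = M-below-j ν∈jκ
            Mw  = M-below-j w∈jW
            η∉κ = index∉κ (code-not-in-range Mν Mw MF ν∉j P) η∈jθ m
        in η , index∈jκ η∈jθ η∉κ θ-le , η∉κ , w , m , F , MF , AM.pair↑ Mw Mν MF P , hF

-- Order types of the traces of `k(g)` below the critical point of `k`

module OrderTypeUniqueness {ℓ} (em : ExcludedMiddle ℓ) (𝒰 : Universe ℓ) (zfc : IsZFC 𝒰) where
  open Universe 𝒰
  open Relativized 𝒰 (𝕍 𝒰)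
  open SetTheory em 𝒰 zfc
  open Embeddings em 𝒰 zfc

  module _ {N M : V → Set ℓ} {k : V → V} {lam : V} (trN : Transitive N) (trM : Transitive M)
           (emb : IsElementaryEmbedding 𝒰 N M k) (Nλ : N lam) (crit : IsCriticalPoint 𝒰 k lam) where
    open Embedding trN trM emb
    private
      module AN = Absoluteness trN
      module AM = Absoluteness trM
      K = proj₁ (IsElementaryEmbedding.isClass emb)
      K-spec = proj₂ (IsElementaryEmbedding.isClass emb)

    -- The data are unpacked in absolute form: `h` enumerates {y : k(g)(y) < λ} increasingly, and
    -- the aim is `h(x) = k(x)` for all `x < α`.
    module Collapse {g α h δ : V} (Ng : N g) (Nα : N α) (oα : IsOrdinal α) (gf : Functional g) (gi : Injective g)
      (gr : ∀ {x y} → Maps g x y → x ∈ α × y ∈ lam) (gt : ∀ {x} → x ∈ α → ∃ λ y → Maps g x y)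
      (hδ : ∀ {x z} → x ∈ δ → z ∈ x → z ∈ δ) (hf : Functional h) (hi : Injective h)
      (ha : ∀ {x} → x ∈ δ → ∃ λ y → ∃ λ z → Maps h x y × Maps (k g) y z × z ∈ lam)
      (hb : ∀ {y z} → Maps (k g) y z → z ∈ lam → ∃ λ x → x ∈ δ × Maps h x y)
      (hm : ∀ {x y u v} → x ∈ δ → y ∈ δ → Maps h x u → Maps h y v → x ∈ y ⇔ u ∈ v) where

      N∈α : ∀ {x} → x ∈ α → N x
      N∈α = trN _ _ Nα

      -- The value `g(x) < λ` is fixed by `k`, so it is also the value of `k(g)` at `k(x)`.
      hit : ∀ {x} → x ∈ α → ∃ λ z → z ∈ lam × Maps (k g) (k x) z
      hit {x} x∈α =
        let (z , m) = gt x∈α ; z∈λ = proj₂ (gr m)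
        in z , z∈λ , subst (Maps (k g) (k x)) (proj₁ (proj₂ crit) z z∈λ) (maps→ Ng m)

      -- Conversely a value below `λ` is `k` of itself, so by injectivity its argument is an image
      -- under `k`.
      source : ∀ {y z} → Maps (k g) y z → z ∈ lam → ∃ λ x → x ∈ α × y ≡ k x
      source {y} {z} m z∈λ =
        let m₁ = subst (Maps (k g) y) (sym (proj₁ (proj₂ crit) z z∈λ)) m
            (x , x∈α , n) = preimage Ng Nα (trN _ _ Nλ z∈λ) (dom→ Ng Nα (λ n → proj₁ (gr n)) m) m₁
        in x , x∈α , injective→ Ng gi m₁ (maps→ Ng n)

      Good : V → Set ℓ
      Good x = x ∈ δ × Maps h x (k x)

      -- If `β` is the index of `k(x)`, the induction hypothesis identifies the elements of `β` with
      -- those of `x`, so `β = x` by extensionality.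
      progress : ∀ {x} → x ∈ α → (∀ {y} → y ∈ x → Good y) → Good x
      progress {x} x∈α below =
        let (z , z∈λ , m) = hit x∈α
            (β , β∈δ , n) = hb m z∈λ
            β≡x = ext (β⊆x β∈δ n) (x⊆β β∈δ n)
        in subst (_∈ δ) β≡x β∈δ , subst (λ t → Maps h t (k x)) β≡x n
        where
        β⊆x : ∀ {β} → β ∈ δ → Maps h β (k x) → ∀ γ → γ ∈ β → γ ∈ x
        β⊆x β∈δ n γ γ∈β =
          let γ∈δ = hδ β∈δ γ∈β
              (u , z , hu , gu , z∈λ) = ha γ∈δ
              (y , y∈α , u≡ky) = source gu z∈λ
              u∈kx = to (hm γ∈δ β∈δ hu n) γ∈β
              y∈x = ∈← (N∈α y∈α) (N∈α x∈α) (subst (_∈ k x) u≡ky u∈kx)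
              (_ , hy) = below y∈x
          in subst (_∈ x) (hi hy (subst (Maps h γ) u≡ky hu)) y∈x
        x⊆β : ∀ {β} → β ∈ δ → Maps h β (k x) → ∀ y → y ∈ x → y ∈ β
        x⊆β β∈δ n y y∈x =
          let (y∈δ , hy) = below y∈x
          in from (hm y∈δ β∈δ hy n) (∈→ (N∈α (ord-trans oα x∈α y∈x)) (N∈α x∈α) y∈x)

      abstract
        good : ∀ {x} → x ∈ α → Good x
        good {x} x∈α = byContradiction λ bad →
            -- The class `K` of the embedding enters as a relation symbol, which makes `h(x) = k(x)`
            -- a formula to which `least` applies.
            let (m , m∈α , m-bad , min) = least (¬̇ (v0 ∈̇ v1 ∧̇ ∃̇ (rel K (v1 ∷ v0 ∷ []) ∧̇ mapsᶠ v3 v1 v0))) (δ ∷ h ∷ []) α x∈α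
                                            (λ { (x∈δ , q) → bad (x∈δ , decode q) })
                (m∈δ , hm) = progress m∈α λ {y} y∈m → byContradiction λ y-bad →
                               min y (ord-trans oα m∈α y∈m) (λ { (y∈δ , q) → y-bad (y∈δ , decode q) }) y∈m
            in m-bad (m∈δ , k m , _ , from (K-spec _ _) (N∈α m∈α , refl) , hm)
          where
          decode : ∀ {x} → (∃ᴰ[ y ] (K ∋ (x ∷ y ∷ []) × Maps h x y)) → Maps h x (k x)
          decode (y , _ , Kxy , m) = subst (Maps h _) (sym (proj₂ (to (K-spec _ _) Kxy))) m

        unique : δ ≡ α
        unique = ext δ⊆α λ z z∈α → proj₁ (good z∈α)
          where
          δ⊆α : ∀ γ → γ ∈ δ → γ ∈ α
          δ⊆α γ γ∈δ =
            let (u , z , hu , gu , z∈λ) = ha γ∈δ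
                (y , y∈α , u≡ky) = source gu z∈λ
                (_ , hy) = good y∈α
            in subst (_∈ α) (hi hy (subst (Maps h γ) u≡ky hu)) y∈α

    -- If g ∈ N injects α into λ = crit k, then {y : k(g)(y) < λ} = k″α, so its order type is α.
    abstract
      orderType-unique : ∀ {g α h δ} → N g → N α → IsOrdinal α → On.IsInjectionᴰ 𝒰 N g α lam →
                         M h → M δ → On.IsOrderTypeᴰ 𝒰 M h δ (k g) lam → δ ≡ α
      orderType-unique Ng Nα oα gi Mh Mδ ot =
        let (gf , gj , gr , gt) = AN.injection↑ Ng Nα gi
            (hδ , hf , hi , ha , hb , hm) = AM.orderType↑ Mh Mδ (image Ng) ot
        in Collapse.unique Ng Nα oα (gf _ _ _ _ _ _) (gj _ _ _ _ _ _) (gr _ _ _ _)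
             (λ x∈α → let (y , _ , m) = gt _ _ x∈α in y , m)
             (λ x∈δ z∈x → hδ _ _ x∈δ _ _ z∈x) (hf _ _ _ _ _ _) (hi _ _ _ _ _ _)
             (λ x∈δ → let (y , _ , z , _ , q) = ha _ _ x∈δ in y , z , q)
             (λ n z∈λ → let (x , _ , q) = hb _ _ _ _ n z∈λ in x , q)
             (hm _ _ _ _ _ _ _ _)

-- The ultrafilter derived from `j` and `η`

module DerivedUltrafilter {ℓ} (em : ExcludedMiddle ℓ) (𝒰 : Universe ℓ) (zfc : IsZFC 𝒰) where
  open Universe 𝒰
  open Relativized 𝒰 (𝕍 𝒰)
  open SetTheory em 𝒰 zfc
  open Ordertypes em 𝒰 zfc
  open Embeddings em 𝒰 zfc

  module Derived {M : V → Set ℓ} {j : V → V} {κ η : V} (trM : Transitive M)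
                 (emb : IsElementaryEmbedding 𝒰 (𝕍 𝒰) M j) (crit : IsCriticalPoint 𝒰 j κ)
                 (η∈jκ : η ∈ j κ) (η∉κ : ¬ η ∈ κ) where
    open Critical trM emb crit
    private
      J = proj₁ (IsElementaryEmbedding.isClass emb)
      J-spec = proj₂ (IsElementaryEmbedding.isClass emb)

    Mη : M η
    Mη = trM _ _ (image _) η∈jκ

    abstract
      ultrafilter : ∃ λ U → ∀ X → X ∈ U ⇔ (X ⊆ κ × η ∈ j X)
      ultrafilter =
        let (Pκ , hPκ) = pow κ
            (U , hU) = sep (∃̇ (rel J (v1 ∷ v0 ∷ []) ∧̇ v2 ∈̇ v0)) (η ∷ []) Pκ
        in U , λ X → mk⇔
             (λ X∈U → let (X∈P , Y , _ , JXY , η∈Y) = to (hU X) X∈U in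
                to (hPκ X) X∈P , subst (η ∈_) (sym (proj₂ (to (J-spec X Y) JXY))) η∈Y)
             λ { (X⊆κ , η∈jX) → from (hU X) (from (hPκ X) X⊆κ , j X , _ , from (J-spec X (j X)) (_ , refl) , η∈jX) }

    U : V
    U = proj₁ ultrafilter

    U-spec : ∀ X → X ∈ U ⇔ (X ⊆ κ × η ∈ j X)
    U-spec = proj₂ ultrafilter

    abstract
      isUltrafilter : IsUltrafilter 𝒰 U κ
      isUltrafilter = record
        { subsets = λ X X∈U → proj₁ (to (U-spec X) X∈U)
        ; whole   = from (U-spec κ) ((λ _ _ z∈κ → z∈κ) , η∈jκ)
        ; proper  = λ X X∈U empty →
            push (∀̇ ¬̇ (v0 ∈̇ v1)) (X ∷ []) (all𝕍 _) empty η Mη (proj₂ (to (U-spec X) X∈U))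
        ; upward  = λ X Y X∈U X⊆Y Y⊆κ → from (U-spec Y) (Y⊆κ , subset→ _ _ X⊆Y η _ (proj₂ (to (U-spec X) X∈U)))
        ; meet    = λ X Y Z X∈U Y∈U hZ → from (U-spec Z)
            ( (λ z _ z∈Z → proj₁ (to (U-spec X) X∈U) z _ (proj₁ (to (hZ z) z∈Z)))
            , from (push (∀̇ (v0 ∈̇ v3 ⇔̇ v0 ∈̇ v1 ∧̇ v0 ∈̇ v2)) (X ∷ Y ∷ Z ∷ []) (all𝕍 _) (λ z _ → hZ z) η Mη)
                (proj₂ (to (U-spec X) X∈U) , proj₂ (to (U-spec Y) Y∈U)))
        ; ultra   = λ X Y X⊆κ hY → decide X Y X⊆κ hY em
        }
        where
        decide : ∀ X Y → X ⊆ κ → (∀ z → z ∈ Y ⇔ (z ∈ κ × ¬ z ∈ X)) → Dec (η ∈ j X) → X ∈ U ⊎ Y ∈ U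
        decide X Y X⊆κ hY (yes p) = inj₁ (from (U-spec X) (X⊆κ , p))
        decide X Y X⊆κ hY (no ¬p) = inj₂ (from (U-spec Y)
          ( (λ z _ z∈Y → proj₁ (to (hY z) z∈Y))
          , from (push (∀̇ (v0 ∈̇ v2 ⇔̇ v0 ∈̇ v3 ∧̇ ¬̇ (v0 ∈̇ v1))) (X ∷ Y ∷ κ ∷ []) (all𝕍 _) (λ z _ → hY z) η Mη) (η∈jκ , ¬p)))

      isNonprincipal : IsNonprincipal 𝒰 U κ
      isNonprincipal (x , x∈κ , h) =
        let (s , hs) = upair x x
            s∈U = from (h s) ((λ z _ z∈s → subst (_∈ κ) (sym ([ (λ e → e) , (λ e → e) ]′ (to (hs z) z∈s))) x∈κ) , from (hs x) (inj₁ refl))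
            η≡jx = push (∀̇ (v0 ∈̇ v2 ⇒̇ v0 ≡̇ v1)) (x ∷ s ∷ []) (all𝕍 _)
                     (λ z _ z∈s → [ (λ e → e) , (λ e → e) ]′ (to (hs z) z∈s)) η Mη (proj₂ (to (U-spec s) s∈U))
        in η∉κ (subst (_∈ κ) (trans (sym (fixed x∈κ)) (sym η≡jx)) x∈κ)

      -- `S` is listed in `ν < κ` steps, which `j` fixes, so each member of `j(S)` is `j(X₀)` for
      -- some `X₀ ∈ S` and contains `η`. Hence so does `j` of the intersection.
      isComplete : IsComplete 𝒰 U κ
      isComplete S S⊆U (ν , _ , (_ , (f , _ , bij@((_ , f-tot , f-fun) , f-ran , _ , f-onto)) , _) , ν∈κ) =
        let (B , hB) = sep (∀∈ v1 (v1 ∈̇ v0)) (S ∷ []) κ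
            η∈jB = from (push (∀̇ (v0 ∈̇ v1 ⇔̇ v0 ∈̇ v2 ∧̇ ∀∈ v3 (v1 ∈̇ v0))) (B ∷ κ ∷ S ∷ []) (all𝕍 _) (λ z _ → hB z) η Mη)
                     (η∈jκ , λ X _ → seedIn)
        in B , from (U-spec B) ((λ z _ z∈B → proj₁ (to (hB z) z∈B)) , η∈jB)
             , λ x → mk⇔ (λ x∈B → let (x∈κ , q) = to (hB x) x∈B in x∈κ , λ X → q X _)
                         λ { (x∈κ , q) → from (hB x) (x∈κ , λ X _ → q X) }
        where
        onto : ∀ {X} → X ∈ S → ∃ λ y → y ∈ ν × Maps f y X
        onto {X} X∈S = let (y , _ , m) = f-onto X _ X∈S in y , bijection-dom bij m , m
        seedIn : ∀ {X} → X ∈ j S → η ∈ X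
        seedIn {X} X∈jS =
          let (y , y∈jν , m) = onto→ {f} {ν} {S} _ _ _ onto X∈jS
              y∈ν = subst (y ∈_) (fixed ν∈κ) y∈jν
              (X₀ , _ , m₀) = f-tot y _ y∈ν
              jy≡y = fixed (ord-trans κ-ordinal ν∈κ y∈ν)
              jX₀≡X = functional→ _ (f-fun _ _ _ _ _ _) (subst (λ t → Maps (j f) t (j X₀)) jy≡y (maps→ _ m₀)) m
          in subst (η ∈_) jX₀≡X (proj₂ (to (U-spec X₀) (S⊆U X₀ _ (f-ran _ _ _ _ m₀))))

      -- If `h` covers `X` from `δ < κ`, then `η` is a value of `j(h)` at a fixed ordinal, hence
      -- `η = j(y) = y` for some `y < κ`.
      not-small : ∀ {X δ h} → X ∈ U → δ ∈ κ → Functional h → (∀ {y} → y ∈ X → ∃ λ x → x ∈ δ × Maps h x y) → ⊥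
      not-small {X} {δ} {h} X∈U δ∈κ h-fun h-onto =
        let (X⊆κ , η∈jX) = to (U-spec X) X∈U
            (x , x∈jδ , m) = onto→ {h} {δ} {X} _ _ _ h-onto η∈jX
            x∈δ = subst (x ∈_) (fixed δ∈κ) x∈jδ
            m′ = subst (λ t → Maps (j h) t η) (sym (fixed (ord-trans κ-ordinal δ∈κ x∈δ))) m
            (y , y∈X , n) = preimage-value {h} {X} {x} _ _ _ η∈jX m′
            y∈κ = X⊆κ y _ y∈X
        in η∉κ (subst (_∈ κ) (trans (sym (fixed y∈κ)) (functional→ _ h-fun (maps→ _ n) m′)) y∈κ)

      -- The order type of `X` is at most `κ`; by `not-small` it is `κ`, and no smaller ordinal is
      -- equinumerous with `X`.
      isUniform : IsUniform 𝒰 U κ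
      isUniform X X∈U = κ-ordinal , [ short , full ]′ le , λ { α _ α∈κ (f , _ , bij@((_ , _ , f-fun) , _ , _ , f-onto)) →
          not-small X∈U α∈κ (f-fun _ _ _ _ _ _) λ y∈X → let (x , _ , m) = f-onto _ _ y∈X in x , bijection-dom bij m , m }
        where
        open OrderType (orderType {κ} {X} κ-ordinal (proj₁ (to (U-spec X) X∈U) _ _))
        short : δ ∈ κ → Equinumerous κ X
        short δ∈κ = ⊥-elim (not-small X∈U δ∈κ fun λ y∈X → let (x , m) = onto y∈X in x , dom m , m)
        full : δ ≡ κ → Equinumerous κ X
        full δ≡κ = subst (λ t → Equinumerous t X) δ≡κ (equinumerous {h} {δ} {X} fun inj
          (λ x∈δ → let (y , m) = total x∈δ in y , ran m , m) (λ y∈X → let (x , m) = onto y∈X in x , dom m , m))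

-- Statements to be moved along the embeddings

module Statements {ℓ} (𝒰 : Universe ℓ) (D : Universe.V 𝒰 → Set ℓ) where
  open Universe 𝒰
  open Relativized 𝒰 D
  open On 𝒰 D

  -- H(ξ) = ⟨ν , F⟩ where the order type of {y : g(y) < ν} belongs to F.
  Guessedᴰ : V → V → V → Set ℓ
  Guessedᴰ H ξ g = ∃ᴰ[ w ] ∃ᴰ[ ν ] ∃ᴰ[ F ] ∃ᴰ[ δ ] ∃ᴰ[ h ]
    (Maps H ξ w × IsOrderedPair w ν F × δ ∈ F × IsOrderTypeᴰ h δ g ν)

  -- With `g = s(e(x))`, `ζ` is the order type of {y : g(y) < ν}. Evaluated in `M` at `j(e)`, `j(s)`
  -- and `λ`, this will define `i(e)(x)` there.
  TraceTypeᴰ : V → V → V → V → V → Set ℓ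
  TraceTypeᴰ e s ν x ζ = ∃ᴰ[ α ] ∃ᴰ[ g ] ∃ᴰ[ h ] (Maps e x α × Maps s α g × IsOrderTypeᴰ h ζ g ν)

  -- A form of |δ| < |δ′| that mentions no cardinals and is easy to transfer: `δ′` does not inject
  -- into an image of `δ`.
  NotCoveredᴰ : V → V → Set ℓ
  NotCoveredᴰ δ δ′ = ∀ᴰ[ b ] ∀ᴰ[ c ] (¬ (Functionalᴰ b × Injectiveᴰ c
    × (∀ᴰ[ x ] (x ∈ δ′ → ∃ᴰ[ y ] (y ∈ δ × (∃ᴰ[ ζ ] (Maps b y ζ × Maps c x ζ)))))))

module _ {ℓ} {P : ℕ → Set ℓ} {n : ℕ} where

  guessedᶠ : Fin n → Fin n → Fin n → Formula P n
  guessedᶠ H ξ g = ∃̇ ∃̇ ∃̇ ∃̇ ∃̇ (mapsᶠ (up H) (up ξ) v4 ∧̇ pairᶠ v4 v3 v2 ∧̇ v1 ∈̇ v2 ∧̇ isOrderTypeᶠ v0 v1 (up g) v3)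
    where
    up : Fin n → Fin (5 + n)
    up x = suc (suc (suc (suc (suc x))))

  traceTypeᶠ : Fin n → Fin n → Fin n → Fin n → Fin n → Formula P n
  traceTypeᶠ e s ν x ζ = ∃̇ ∃̇ ∃̇ (mapsᶠ (up e) (up x) v2 ∧̇ mapsᶠ (up s) v2 v1 ∧̇ isOrderTypeᶠ v0 (up ζ) v1 (up ν))
    where
    up : Fin n → Fin (3 + n)
    up x = suc (suc (suc x))

  notCoveredᶠ : Fin n → Fin n → Formula P n
  notCoveredᶠ δ δ′ = ∀̇ ∀̇ ¬̇ (functionalᶠ v1 ∧̇ injectiveᶠ v0
    ∧̇ ∀∈ (suc (suc δ′)) (∃∈ (suc (suc (suc δ))) (∃̇ (mapsᶠ v4 v1 v0 ∧̇ mapsᶠ v3 v2 v0))))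

-- The failure of the Galvin property

module NonGalvin {ℓ} (em : ExcludedMiddle ℓ) (𝒰 : Universe ℓ) (zfc : IsZFC 𝒰)
  {κ : Universe.V 𝒰} {M N : Universe.V 𝒰 → Set ℓ} {j i k : Universe.V 𝒰 → Universe.V 𝒰}
  (ng : NonGalvinEmbeddings 𝒰 κ M N j i k) where
  open Universe 𝒰
  open Relativized 𝒰 (𝕍 𝒰)
  open SetTheory em 𝒰 zfc
  open Ordertypes em 𝒰 zfc
  open Embeddings em 𝒰 zfc
  open OrderTypeUniqueness em 𝒰 zfc
  open NonGalvinEmbeddings ng
  open On 𝒰 (𝕍 𝒰)
  open Statements 𝒰 (𝕍 𝒰)

  trM : Transitive M
  trM = IsInnerModel.transitive innerM

  trN : Transitive N
  trN = IsInnerModel.transitive innerN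

  private
    module M = Relativized 𝒰 M
    module AM = Absoluteness trM
    module AN = Absoluteness trN
    module OM = On 𝒰 M
    module ON = On 𝒰 N
    module SM = Statements 𝒰 M
    module J = Critical trM embedj critj
    module I = Embedding {D = 𝕍 𝒰} _ trN embedi
    module K = Embedding trN trM embedk
    module C = Enumerating.Codes em 𝒰 zfc trM embedj critj
  open C using (H)

  lam : V
  lam = i κ

  N-lam : N lam
  N-lam = I.image _

  -- `λ = crit(k)` lies below `k(λ) = k(i(κ)) = j(κ)`.
  lam∈jκ : lam ∈ j κ
  lam∈jκ = subst (lam ∈_) (factor κ) (K.critical-below N-lam critk)

  -- A value `j(x) = k(i(x))` is in the range of `k`, which omits its critical point.
  lam∉range-j : ∀ x → j x ≢ lam
  lam∉range-j x e = K.critical∉range N-lam critk (I.image _) (trans (factor x) e)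

  k-fixed : ∀ {x} → x ∈ lam → k x ≡ x
  k-fixed = proj₁ (proj₂ critk) _

  lam-ordinal : IsOrdinal lam
  lam-ordinal = proj₁ critk

  κ⁺ : V
  κ⁺ = proj₁ cover

  κ⁺-successor : IsSuccessorCardinal κ⁺ κ
  κ⁺-successor = proj₁ (proj₂ cover)

  A : V
  A = proj₁ (proj₂ (proj₂ cover))

  M-A : M A
  M-A = proj₁ (proj₂ (proj₂ (proj₂ cover)))

  i∈A : ∀ {α} → α ∈ κ⁺ → i α ∈ A
  i∈A = proj₁ (proj₂ (proj₂ (proj₂ (proj₂ cover)))) _

  abstract
    -- From the cardinality of `A` in `M` this extracts, in absolute form, a function `b` covering
    -- `A` from some `δ < λ`.
    A-small : ∃ λ δ → δ ∈ lam × ∃ λ b → M b × Functional b × (∀ {x} → x ∈ A → ∃ λ y → y ∈ δ × Maps b y x)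
    A-small =
      let (δ , Mδ , (_ , (b , Mb , (b-pairs , _ , b-fun) , _ , _ , b-onto) , _) , δ∈λ) =
            proj₂ (proj₂ (proj₂ (proj₂ (proj₂ cover))))
      in δ , δ∈λ , b , Mb , AM.functional↑ Mb b-fun , λ {x} x∈A →
           let (y , My , m@(p , Mp , P , p∈b)) = b-onto x (trM _ _ M-A x∈A) x∈A
               (y′ , My′ , x′ , Mx′ , y′∈δ , P′) = b-pairs p Mp p∈b
               y′≡y = pair-injˡ (AM.pair↑ Mp My′ Mx′ P′) (AM.pair↑ Mp My (trM _ _ M-A x∈A) P)
           in y , subst (_∈ δ) y′≡y y′∈δ , AM.maps↑ My (trM _ _ M-A x∈A) m

  δ₀ b : V
  δ₀ = proj₁ A-small
  b  = proj₁ (proj₂ (proj₂ A-small))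

  δ₀∈lam : δ₀ ∈ lam
  δ₀∈lam = proj₁ (proj₂ A-small)

  M-b : M b
  M-b = proj₁ (proj₂ (proj₂ (proj₂ A-small)))

  b-fun : Functional b
  b-fun = proj₁ (proj₂ (proj₂ (proj₂ (proj₂ A-small))))

  b-onto : ∀ {x} → x ∈ A → ∃ λ y → y ∈ δ₀ × Maps b y x
  b-onto = proj₂ (proj₂ (proj₂ (proj₂ (proj₂ A-small))))

  abstract
    seed : ∃ λ η → η ∈ j κ × ¬ η ∈ κ × ∃ λ w → Maps (j H) η w × ∃ λ F → M F × IsOrderedPair w lam F ×
             (∀ x → x ∈ F ⇔ (x ∈ A × x ∈ j κ))
    seed = C.seed lam∈jκ lam∉range-j (ord-trans (J.ordinal→ _ J.κ-ordinal) lam∈jκ δ₀∈lam) M-A M-b b-fun b-onto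

  η w F : V
  η = proj₁ seed
  w = proj₁ (proj₂ (proj₂ (proj₂ seed)))
  F = proj₁ (proj₂ (proj₂ (proj₂ (proj₂ (proj₂ seed)))))

  η∈jκ : η ∈ j κ
  η∈jκ = proj₁ (proj₂ seed)

  η∉κ : ¬ η ∈ κ
  η∉κ = proj₁ (proj₂ (proj₂ seed))

  jH-η : Maps (j H) η w
  jH-η = proj₁ (proj₂ (proj₂ (proj₂ (proj₂ seed))))

  M-F : M F
  M-F = proj₁ (proj₂ (proj₂ (proj₂ (proj₂ (proj₂ (proj₂ seed))))))

  w-pair : IsOrderedPair w lam F
  w-pair = proj₁ (proj₂ (proj₂ (proj₂ (proj₂ (proj₂ (proj₂ (proj₂ seed)))))))

  F-spec : ∀ x → x ∈ F ⇔ (x ∈ A × x ∈ j κ)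
  F-spec = proj₂ (proj₂ (proj₂ (proj₂ (proj₂ (proj₂ (proj₂ (proj₂ seed)))))))

  open DerivedUltrafilter.Derived em 𝒰 zfc trM embedj critj η∈jκ η∉κ

  abstract
    injections : ∃ λ s → Functional s × (∀ {α g} → Maps s α g → α ∈ κ⁺ × IsInjectionᴰ g α κ)
                       × (∀ {α} → α ∈ κ⁺ → ∃ λ g → Maps s α g)
    injections = injections-below-successor J.κ-ordinal κ⁺-successor

  s : V
  s = proj₁ injections

  s-fun : Functional s
  s-fun = proj₁ (proj₂ injections)

  s-spec : ∀ {α g} → Maps s α g → α ∈ κ⁺ × IsInjectionᴰ g α κ
  s-spec = proj₁ (proj₂ (proj₂ injections))

  κ⁺-ordinal : ∀ {α} → α ∈ κ⁺ → IsOrdinal α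
  κ⁺-ordinal = ord-elem (proj₁ (proj₁ κ⁺-successor))

  abstract
    -- `κ` is a limit cardinal, in a form without cardinals. In `M` the ordinal `κ < j(κ)` is itself
    -- a witness, since `κ` does not inject into `δ`; this reflects to some `δ′ < κ`.
    uncovered : ∀ᴰ[ δ ] (δ ∈ κ → ∃ᴰ[ δ′ ] (δ′ ∈ κ × NotCoveredᴰ δ δ′))
    uncovered δ _ δ∈κ = J.pull (∃∈ v1 (notCoveredᶠ v1 v0)) (δ ∷ κ ∷ []) (all𝕍 _)
        (κ , C.M-below-j J.κ∈jκ , J.κ∈jκ , λ b Mb c Mc (b-fun , c-inj , cov) →
          clash (AM.functional↑ Mb b-fun) (AM.injective↑ Mc c-inj) λ {x} x∈κ →
            let Mx = C.M-below-j (ord-trans (J.ordinal→ _ J.κ-ordinal) J.κ∈jκ x∈κ)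
                (y , My , y∈jδ , ζ , Mζ , m , n) = cov x Mx x∈κ
            in y , subst (y ∈_) (J.fixed δ∈κ) y∈jδ , ζ , AM.maps↑ My Mζ m , AM.maps↑ Mx Mζ n)
      where
      clash : ∀ {b c} → Functional b → Injective c →
              (∀ {x} → x ∈ κ → ∃ λ y → y ∈ δ × ∃ λ ζ → Maps b y ζ × Maps c x ζ) → ⊥
      clash {b} {c} b-fun c-inj cov = J.no-injection {Graph.graph Γ}
          (λ m m′ → let (_ , _ , ζ , _ , p , q) = Graph.inv Γ m ; (_ , _ , ζ′ , _ , p′ , q′) = Graph.inv Γ m′ in
             c-inj q (subst (Maps c _) (b-fun p′ p) q′))
          δ∈κ λ x∈κ → let (y , y∈δ , ζ , m , n) = cov x∈κ in y , y∈δ , Graph.intro Γ x∈κ y∈δ (ζ , _ , m , n)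
        where
        Γ : Graph κ δ (λ x y → ∃ᴰ[ ζ ] (Maps b y ζ × Maps c x ζ))
        Γ = comp κ δ _ (∃̇ (mapsᶠ v6 v1 v0 ∧̇ mapsᶠ v7 v2 v0)) (b ∷ c ∷ []) λ _ _ _ → refl

    -- N knows that i(κ) is a limit cardinal, and k carries this knowledge to M since it fixes δ and δ′.
    uncovered-in-M : ∀ {δ} → δ ∈ lam → ∃ λ δ′ → δ′ ∈ lam × SM.NotCoveredᴰ δ δ′
    uncovered-in-M {δ} δ∈λ =
      let (δ′ , Nδ′ , δ′∈λ , h) = I.push (∀∈ v0 (∃∈ v1 (notCoveredᶠ v1 v0))) (κ ∷ []) (all𝕍 _) uncovered
                                    δ (trN _ _ N-lam δ∈λ) δ∈λ
          h′ = K.push (notCoveredᶠ v0 v1) (δ ∷ δ′ ∷ []) (trN _ _ N-lam δ∈λ ∷ Nδ′ ∷ []) h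
      in δ′ , δ′∈λ , subst₂ SM.NotCoveredᴰ (k-fixed δ∈λ) (k-fixed δ′∈λ) h′

    trace-type : ∀ {α g h δ} → N g → N α → IsOrdinal α → ON.IsInjectionᴰ g α lam →
                 M h → M δ → OM.IsOrderTypeᴰ h δ (k g) lam → δ ≡ α
    trace-type = orderType-unique trN trM embedk N-lam critk

    -- In `M` the order type of {y : j(g)(y) < λ} is `i(α)`, because `j(g) = k(i(g))`. So it lies in
    -- `A ∩ j(κ) = F`.
    i-guessed : ∀ {α g} → α ∈ κ⁺ → Maps s α g → SM.Guessedᴰ (j H) η (j g)
    i-guessed {α} {g} α∈κ⁺ m =
      let gi = proj₂ (s-spec m)
          -- `orderType-below` holds for every `ν < κ`; `j` makes it available at `λ < j(κ)` and
          -- puts the order type below `j(κ)`.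
          ot = J.push (∀∈ v1 (∃∈ v2 (∃̇ isOrderTypeᶠ v0 v1 v3 v2))) (g ∷ κ ∷ []) (all𝕍 _)
                 (λ ν _ ν∈κ → let (δ , δ∈κ , h , o) = C.orderType-below (κ⁺-ordinal α∈κ⁺) gi ν∈κ in δ , _ , δ∈κ , h , _ , o)
          (δ , Mδ , δ∈jκ , h , Mh , o) = ot lam (C.M-below-j lam∈jκ) lam∈jκ
          gi′ = I.push (isInjectionᶠ v0 v1 v2) (g ∷ α ∷ κ ∷ []) (all𝕍 _) gi
          δ≡iα = trace-type (I.image _) (I.image _) (I.ordinal→ _ (κ⁺-ordinal α∈κ⁺)) gi′ Mh Mδ
                   (subst (λ t → OM.IsOrderTypeᴰ h δ t lam) (sym (factor g)) o)
          (Mη , Mw , m′) = AM.maps↓ (J.image _) jH-η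
          (Mλ , _ , P) = AM.pair↓ Mw w-pair
      in w , Mw , lam , Mλ , F , M-F , δ , Mδ , h , Mh , m′ , P
       , from (F-spec δ) (subst (_∈ A) (sym δ≡iα) (i∈A α∈κ⁺) , δ∈jκ) , o

    guessed-in-U : ∀ {α g X} → α ∈ κ⁺ → Maps s α g → (∀ ξ → ξ ∈ X ⇔ (ξ ∈ κ × Guessedᴰ H ξ g)) → X ∈ U
    guessed-in-U {α} {g} {X} α∈κ⁺ m hX = from (U-spec X) ((λ z _ z∈X → proj₁ (to (hX z) z∈X)) ,
      from (J.push (∀̇ (v0 ∈̇ v1 ⇔̇ v0 ∈̇ v2 ∧̇ guessedᶠ v3 v0 v4)) (X ∷ κ ∷ H ∷ g ∷ []) (all𝕍 _) (λ ξ _ → hX ξ) η Mη)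
        (η∈jκ , i-guessed α∈κ⁺ m))

  -- `e` lists `κ` many indices injectively, and `B` is a member of `U` contained in each of the
  -- sets attached to them.
  module Contradiction {B e : V} (B∈U : B ∈ U) (e-inj : Injective e) (e-fun : Functional e)
    (e-total : ∀ {x} → x ∈ κ → ∃ λ α → α ∈ κ⁺ × Maps e x α)
    (B-guessed : ∀ {ξ x α g} → ξ ∈ B → Maps e x α → Maps s α g → Guessedᴰ H ξ g) where

    Me : M (j e)
    Me = J.image _

    abstract
      -- The choice of the injection `s(e(x))` is moved first by `i` to `N`, at `x < λ`, and then by
      -- `k` to `M`, where `x` is fixed and `k ∘ i = j`.
      value : ∀ {x} → x ∈ lam → ∃ λ α → ∃ λ g → N α × N g × IsOrdinal α × ON.IsInjectionᴰ g α lam ×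
              Maps (i e) x α × Maps (j e) x (k α) × Maps (j s) (k α) (k g)
      value {x} x∈λ =
        let (α , Nα , g , Ng , m , n , o , gi) = I.push
              (∀∈ v0 (∃̇ ∃̇ (mapsᶠ v4 v2 v1 ∧̇ mapsᶠ v5 v1 v0
                 ∧̇ ordinalᶠ v1
                 ∧̇ isInjectionᶠ v0 v1 v3)))
              (κ ∷ e ∷ s ∷ []) (all𝕍 _)
              (λ x _ x∈κ → let (α , α∈κ⁺ , m) = e-total x∈κ ; (g , n) = proj₂ (proj₂ (proj₂ injections)) α∈κ⁺ in
                 α , _ , g , _ , m , n , κ⁺-ordinal α∈κ⁺ , proj₂ (s-spec n))
              x (trN _ _ N-lam x∈λ) x∈λ
            m′ = AN.maps↑ (trN _ _ N-lam x∈λ) Nα m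
            n′ = AN.maps↑ Nα Ng n
        in α , g , Nα , Ng , AN.ordinal↑ Nα o , gi , m′
         , subst₂ (λ t u → Maps t u (k α)) (factor e) (k-fixed x∈λ) (K.maps→ (I.image _) m′)
         , subst (λ t → Maps t (k α) (k g)) (factor s) (K.maps→ (I.image _) n′)

      -- Here `η ∈ j(B)`, and `j(H)(η)` is the pair of `λ` and `F`; comparing it with the pair
      -- provided by the guess gives `ν = λ` and `F′ = F`.
      guessed-value : ∀ {α g} → ∀ {x} → Maps (j e) x α → Maps (j s) α g →
                      ∃ λ δ → δ ∈ F × ∃ λ h → M h × OM.IsOrderTypeᴰ h δ g lam
      guessed-value {α} {g} {x} m n =
        let (Mx , Mα , m′) = AM.maps↓ Me m
            (_ , Mg , n′)  = AM.maps↓ (J.image _) n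
            (w′ , Mw′ , ν , Mν , F′ , MF′ , δ , Mδ , h , Mh , r , P , δ∈F′ , o) =
              J.push (∀∈ v0 (∀̇ ∀̇ ∀̇ (mapsᶠ v5 v2 v1 ⇒̇ mapsᶠ v6 v1 v0 ⇒̇ guessedᶠ v7 v3 v0)))
                (B ∷ e ∷ s ∷ H ∷ []) (all𝕍 _) (λ ξ _ ξ∈B x _ α _ g _ m n → B-guessed ξ∈B m n)
                η Mη (proj₂ (to (U-spec B) B∈U)) x Mx α Mα g Mg m′ n′
            w≡w′ = J.functional→ _ C.H-fun jH-η (AM.maps↑ Mη Mw′ r)
            P′   = subst (λ t → IsOrderedPair t ν F′) (sym w≡w′) (AM.pair↑ Mw′ Mν MF′ P)
        in δ , subst (δ ∈_) (pair-injʳ P′ w-pair) δ∈F′ , h , Mh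
         , subst (OM.IsOrderTypeᴰ h δ g) (pair-injˡ P′ w-pair) o

      trace-exists : ∀ {x} → x ∈ lam → ∃ λ ζ → ζ ∈ A × SM.TraceTypeᴰ (j e) (j s) lam x ζ
      trace-exists x∈λ =
        let (α , g , Nα , Ng , o , gi , _ , m , n) = value x∈λ
            (δ , δ∈F , h , Mh , t) = guessed-value m n
            (Mx , Mα , m′) = AM.maps↓ Me m
            (_ , Mg , n′)  = AM.maps↓ (J.image _) n
        in δ , proj₁ (to (F-spec δ) δ∈F) , k α , Mα , k g , Mg , h , Mh , m′ , n′ , t

      -- Uniqueness of order types. It shows that the map `x ↦ i(e)(x)` on `λ` has a definition in
      -- `M`.
      trace-value : ∀ {x ζ} → x ∈ lam → M ζ → SM.TraceTypeᴰ (j e) (j s) lam x ζ → Maps (i e) x ζ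
      trace-value {x} {ζ} x∈λ Mζ (α′ , Mα′ , g′ , Mg′ , h , Mh , m′ , n′ , t) =
        let (α , g , Nα , Ng , o , gi , r , m , n) = value x∈λ
            kα≡α′ = J.functional→ _ e-fun m (AM.maps↑ (proj₁ (AM.maps↓ Me m)) Mα′ m′)
            kg≡g′ = J.functional→ _ s-fun n (subst (λ a → Maps (j s) a g′) (sym kα≡α′) (AM.maps↑ Mα′ Mg′ n′))
            ζ≡α   = trace-type Ng Nα o gi Mh Mζ (subst (λ u → OM.IsOrderTypeᴰ h ζ u lam) (sym kg≡g′) t)
        in subst (Maps (i e) x) (sym ζ≡α) r

      -- Comprehension inside `M`, taken over from V by elementarity. The formula is closed, so that
      -- any elements of `M`, such as `A` and `λ`, may serve as parameters.
      trace-function : ∀ d → M d → ∃ λ c → M c × (∀ x → M x → ∀ ζ → M ζ →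
                         M.Maps c x ζ ⇔ (x ∈ d × ζ ∈ A × SM.TraceTypeᴰ (j e) (j s) lam x ζ))
      trace-function d Md =
        J.push (∀̇ ∀̇ ∀̇ ∀̇ ∀̇ ∃̇ ∀̇ ∀̇ (mapsᶠ v2 v1 v0 ⇔̇ v1 ∈̇ v7 ∧̇ v0 ∈̇ v6 ∧̇ traceTypeᶠ v5 v4 v3 v1 v0)) [] []
          (λ d _ a _ e _ s _ ν _ → exists d a e s ν) d Md A M-A (j e) Me (j s) (J.image _) lam (C.M-below-j lam∈jκ)
        where
        exists : ∀ d a e s ν → ∃ᴰ[ c ] ∀ᴰ[ x ] ∀ᴰ[ ζ ] (Maps c x ζ ⇔ (x ∈ d × ζ ∈ a × TraceTypeᴰ e s ν x ζ))
        exists d a e s ν = Graph.graph Γ , _ , λ x _ ζ _ → mk⇔ (Graph.inv Γ) λ { (p , q , r) → Graph.intro Γ p q r }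
          where
          Γ : Graph d a (TraceTypeᴰ e s ν)
          Γ = comp d a _ (traceTypeᶠ v5 v6 v7 v1 v0) (e ∷ s ∷ ν ∷ []) λ _ _ _ → refl

      -- The restriction `c` of `x ↦ i(e)(x)` to `δ′` is an injection into `A`, which `b` covers
      -- from `δ₀`, against the choice of `δ′`.
      contradiction : ⊥
      contradiction =
        let (δ′ , δ′∈λ , no-cover) = uncovered-in-M δ₀∈lam
            Mλ  = C.M-below-j lam∈jκ
            Mδ′ = trM _ _ Mλ δ′∈λ
            (c , Mc , hc) = trace-function δ′ Mδ′
            at : ∀ {x} → x ∈ δ′ → x ∈ lam
            at = ord-trans lam-ordinal δ′∈λ
        in no-cover b M-b c Mc
             ( AM.functional↓ b-fun
             , (λ x Mx y My ζ Mζ m n →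
                  let (x∈ , _ , p) = to (hc x Mx ζ Mζ) m
                      (y∈ , _ , q) = to (hc y My ζ Mζ) n
                  in I.injective→ _ e-inj (trace-value (at x∈) Mζ p) (trace-value (at y∈) Mζ q))
             , λ x Mx x∈δ′ →
                  let (ζ , ζ∈A , p) = trace-exists (at x∈δ′)
                      (y , y∈δ₀ , m) = b-onto ζ∈A
                      (My , Mζ , m′) = AM.maps↓ M-b m
                  in y , My , y∈δ₀ , ζ , Mζ , m′ , from (hc x Mx ζ Mζ) (x∈δ′ , ζ∈A , p))

  -- `X` is the set `A_α` belonging to the injection chosen for `α`.
  Member : V → V → Set ℓ
  Member α X = ∃ᴰ[ g ] (Maps s α g × (∀ᴰ[ ξ ] (ξ ∈ X ⇔ (ξ ∈ κ × Guessedᴰ H ξ g))))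

  abstract
    sequence : ∃ λ A → IsFunctionOn A κ⁺ × (∀ {α X} → Maps A α X → α ∈ κ⁺ × Member α X)
    sequence =
      let (Pκ , hPκ) = pow κ
          Γ = graph Pκ
      in Graph.graph Γ
       , ( (λ p _ p∈ → let (α , X , α∈ , _ , P) = Graph.pairs Γ p p∈ in α , _ , X , _ , α∈ , P)
         , (λ α _ α∈ → let (g , m) = proj₂ (proj₂ (proj₂ injections)) α∈
                           (X , hX) = sep (guessedᶠ v1 v0 v2) (H ∷ g ∷ []) κ
                       in X , _ , Graph.intro Γ α∈ (from (hPκ X) λ z _ z∈X → proj₁ (to (hX z) z∈X)) (g , _ , m , λ ξ _ → hX ξ))
         , λ α _ X _ Y _ m n → same (proj₂ (proj₂ (Graph.inv Γ m))) (proj₂ (proj₂ (Graph.inv Γ n))))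
       , λ m → let (α∈ , _ , q) = Graph.inv Γ m in α∈ , q
      where
      graph : ∀ Pκ → Graph κ⁺ Pκ Member
      graph Pκ = comp κ⁺ Pκ Member (∃̇ (mapsᶠ v6 v2 v0 ∧̇ ∀̇ (v0 ∈̇ v2 ⇔̇ v0 ∈̇ v8 ∧̇ guessedᶠ v9 v0 v1)))
                   (s ∷ κ ∷ H ∷ []) λ _ _ _ → refl
      same : ∀ {α X Y} → Member α X → Member α Y → X ≡ Y
      same {α} {X} {Y} (g , _ , m , hX) (g′ , _ , m′ , hY) =
        let hY′ = subst (λ g → ∀ᴰ[ ξ ] (ξ ∈ Y ⇔ (ξ ∈ κ × Guessedᴰ H ξ g))) (s-fun m′ m) hY
        in ext (λ z p → from (hY′ z _) (to (hX z _) p)) (λ z p → from (hX z _) (to (hY′ z _) p))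

    not-Gal : ¬ Gal 𝒰 κ U κ κ⁺
    not-Gal gal =
      let (a , a-fun , a-spec) = sequence
          (I , I⊆κ⁺ , (_ , (e , _ , (_ , e-tot , e-fun) , e-ran , e-inj , _) , _) , B , B∈U , hB) =
            gal a a-fun λ α X m → let (α∈κ⁺ , g , _ , n , hX) = a-spec m in guessed-in-U α∈κ⁺ n λ ξ → hX ξ _
      in Contradiction.contradiction {B} {e} B∈U (e-inj _ _ _ _ _ _) (e-fun _ _ _ _ _ _)
           (λ x∈κ → let (α , _ , m) = e-tot _ _ x∈κ in α , I⊆κ⁺ α _ (e-ran _ _ _ _ m) , m)
           λ {ξ} {x} {α} {g} ξ∈B m n →
             -- A point of `B` lies in the set at index `e(x)`; single-valuedness of `s` identifies
             -- the injection used there with the given `g`.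
             let α∈I = e-ran _ _ _ _ m
                 (X , _ , r) = proj₁ (proj₂ a-fun) α _ (I⊆κ⁺ α _ α∈I)
                 (_ , g′ , _ , n′ , hX) = a-spec r
                 (_ , q) = to (hX ξ _) (proj₂ (to (hB ξ) ξ∈B) α X α∈I r)
             in subst (Guessedᴰ H ξ) (s-fun n′ n) q

theorem1p2 : ∀ {ℓ} → ExcludedMiddle ℓ → (𝒰 : Universe ℓ) → IsZFC 𝒰 →
    (κ : Universe.V 𝒰) → IsNonGalvinCardinal 𝒰 κ →
    ∃ λ U →
    IsCompleteUltrafilter 𝒰 U κ
    × (∃ λ κ⁺ → Relativized.IsSuccessorCardinal 𝒰 (𝕍 𝒰) κ⁺ κ × (¬ Gal 𝒰 κ U κ κ⁺))
    × ((∃ λ μ → Relativized.IsSuccessorCardinal 𝒰 (𝕍 𝒰) μ κ × Relativized.IsPowerCardinal 𝒰 (𝕍 𝒰) μ κ)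
    → IsNonGalvinUltrafilter 𝒰 U κ)
theorem1p2 em 𝒰 zfc κ (_ , _ , _ , _ , _ , _ , ng) =
    U
  , (isUltrafilter , isNonprincipal , isComplete)
  , (κ⁺ , κ⁺-successor , not-Gal)
  -- The cardinal `μ` is both `2^κ` and a successor of `κ`, so uniqueness identifies it with the
  -- `κ⁺` for which the property fails.
  , λ { (μ , μ-successor , μ-power) → isUltrafilter , isUniform , μ , μ-power ,
        subst (λ t → ¬ Gal 𝒰 κ U κ t) (Ordertypes.successor-unique em 𝒰 zfc κ⁺-successor μ-successor) not-Gal }
  where
  open NonGalvin em 𝒰 zfc ng
  open DerivedUltrafilter.Derived em 𝒰 zfc trM (NonGalvinEmbeddings.embedj ng) (NonGalvinEmbeddings.critj ng) η∈jκ η∉κ
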